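{- Let $k$ and $s$ be integers with $k \geq 2$ and $s \geq 2$. The limit \[ \lim_{n\rightarrow \infty} \frac{g_k^{(s)}(n)}{n} = (s-1) \sum_{m=1}^{\infty} \left( \frac{1}{s} \right)^{\min \left( r_k^{ -1}(m)\right)} \] exists and converges to an irrational number.
   Context: $\mathbf{N}$ denotes the set of positive integers. For $\ell \in \mathbf{N}$, $r_k(\ell)$ denotes the cardinality of the largest subset of $\{0,1,2,\ldots,\ell-1\}$ that contains no arithmetic progression of length $k$ (a set $\{v+dj : j=0,1,\ldots,k-1\}$ with $d \geq 1$). For $m \in \mathbf{N}$, $r_k^{ -1}(m) = \{\ell \in \mathbf{N} : r_k(\ell) = m\}$, and $\min(r_k^{ -1}(m))$ is its least element. For $n \in \mathbf{N}$, $g_k^{(s)}(n)$ denotes the cardinality of the largest subset of $\{1,2,\ldots,n\}$ that contains no geometric progression of length $k$ whose common ratio is a power of $s$, i.e. no set of the form $\{a (s^d)^j : j = 0,1,\ldots,k-1\}$ with $a, d \in \mathbf{N}$.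
   Formalization: Irrationality is claimed only for k ≥ 3, since for k = 2 the limit is (s−1)/s, which is rational; for k = 2, where r_2^{ -1}(m) is empty for m ≥ 2, such an m contributes 0 to the series. The limit formula is proved for all k ≥ 2. -}

module Defs where

import Algebra.Definitions.RawSemiring
open import Data.Bool using (true; false)
open import Data.Fin using (Fin; toℕ)
open import Data.Fin.Properties using (any?; toℕ<n)
open import Data.Fin.Subset using (Subset; _∈_; ∣_∣)
open import Data.Fin.Subset.Properties using (_∈?_)
open import Data.Integer using (+_)
open import Data.List using (List; []; _∷_; _++_; map; filter)
open import Data.List.Extrema.Nat using (max)
open import Data.Nat using (ℕ; zero; suc; _+_; _*_; _^_; _≤_; _<_; z≤n; s≤s; z<s; s<s; NonZero; _≤?_; _≟_)
open import Data.Nat.Properties using (≤-refl; ≤-reflexive; ≤-trans; <-trans; ≤-<-trans; ^-zeroˡ; ^-monoʳ-<; *-identityʳ; m≤m+n; m≤n+m; m<n⇒m<1+n; anyUpTo?; allUpTo?)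
open import Data.Product using (∃-syntax; _×_; _,_)
open import Data.Rational using (ℚ; 0ℚ; _/_; +-*-rawSemiring)
import Data.Rational as ℚ
import Data.Rational.Properties as ℚ
open import Data.Vec using ([]; _∷_)
open import Relation.Binary.PropositionalEquality using (_≡_; refl; sym; cong; subst)
open import Relation.Nullary using (¬_; ¬?)
open import Relation.Nullary.Decidable using (_×-dec_; map′)
open import Relation.Unary using (Pred; Decidable)
open import Level using (0ℓ)

open Algebra.Definitions.RawSemiring +-*-rawSemiring public using () renaming (_^_ to _^ℚ_)

subsets : ∀ n → List (Subset n)
subsets zero    = [] ∷ []
subsets (suc n) = map (true ∷_) (subsets n) ++ map (false ∷_) (subsets n)

largest : ∀ {n} {P : Pred (Subset n) 0ℓ} → Decidable P → ℕ
largest {n} P? = max 0 (map ∣_∣ (filter P? (subsets n)))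

-- A subset S of Fin n stands for the set of naturals { c + i : i ∈ S },
-- so c = 0 gives the subsets of {0,…,n-1} and c = 1 those of {1,…,n}.
Member : ∀ {n} → ℕ → Subset n → ℕ → Set
Member {n} c S x = ∃[ i ] (c + toℕ {n} i ≡ x × i ∈ S)

member? : ∀ {n} c (S : Subset n) → Decidable (Member c S)
member? c S x = any? (λ i → (c + toℕ i ≟ x) ×-dec (i ∈? S))

HasAP : ∀ {ℓ} → ℕ → Subset ℓ → Set
HasAP k S = ∃[ v ] ∃[ d ] (1 ≤ d × (∀ {j} → j < k → Member 0 S (v + d * j)))

APFree : ∀ {ℓ} → ℕ → Subset ℓ → Set
APFree k S = ¬ HasAP k S

HasGP : ∀ {n} → ℕ → ℕ → Subset n → Set
HasGP k s S = ∃[ a ] ∃[ d ] (1 ≤ a × 1 ≤ d × (∀ {j} → j < k → Member 1 S (a * (s ^ d) ^ j)))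

GPFree : ∀ {n} → ℕ → ℕ → Subset n → Set
GPFree k s S = ¬ HasGP k s S

private
  member-< : ∀ {n} c (S : Subset n) {x} → Member c S x → x < c + n
  member-< zero    S (i , refl , _) = toℕ<n i
  member-< (suc c) S (i , refl , i∈S) = s≤s (member-< c S (i , refl , i∈S))

  n<s^n : ∀ s n → 2 ≤ s → n < s ^ n
  n<s^n s zero    _   = z<s
  n<s^n s (suc n) 2≤s = ≤-<-trans (n<s^n s n 2≤s) (^-monoʳ-< s 2≤s {n} {suc n} ≤-refl)

  -- A progression in S can be chosen with its parameters bounded in terms
  -- of the ambient interval, which makes its existence decidable.
  boundAP : ∀ {ℓ} k (S : Subset ℓ) → HasAP k S →
            ∃[ v ] (v < suc ℓ × ∃[ d ] (d < suc (suc ℓ) × 1 ≤ d × (∀ {j} → j < k → Member 0 S (v + d * j))))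
  boundAP zero S _ = 0 , z<s , 1 , s<s z<s , s≤s z≤n , λ ()
  boundAP (suc zero) S (v , d , 1≤d , h) =
    v , m<n⇒m<1+n (≤-<-trans (m≤m+n v _) (member-< 0 S (h z<s))) , 1 , s<s z<s , s≤s z≤n ,
    λ { z<s → subst (λ z → Member 0 S (v + z)) (d*0 d) (h z<s) }
    where
    d*0 : ∀ d → d * 0 ≡ 0
    d*0 zero = refl
    d*0 (suc d) = d*0 d
  boundAP (suc (suc k)) S (v , d , 1≤d , h) =
    v , m<n⇒m<1+n (≤-<-trans (m≤m+n v _) (member-< 0 S (h z<s))) ,
    d , m<n⇒m<1+n (m<n⇒m<1+n (≤-<-trans (≤-trans (≤-reflexive (sym (*-identityʳ d))) (m≤n+m _ v)) (member-< 0 S (h (s<s z<s))))) ,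
    1≤d , h

  boundGP : ∀ {n} k s (S : Subset n) → HasGP k s S →
            ∃[ a ] (a < suc (suc n) × ∃[ d ] (d < suc (suc n) × 1 ≤ a × 1 ≤ d × (∀ {j} → j < k → Member 1 S (a * (s ^ d) ^ j))))
  boundGP zero s S _ = 1 , s<s z<s , 1 , s<s z<s , s≤s z≤n , s≤s z≤n , λ ()
  boundGP {n} (suc k) s S (a , d , 1≤a , 1≤d , h) = a , m<n⇒m<1+n a<1+n , step k s d 1≤d h
    where
    a<1+n : a < suc n
    a<1+n = subst (_< suc n) (*-identityʳ a) (member-< 1 S (h z<s))
    step : ∀ k s d → 1 ≤ d → (∀ {j} → j < suc k → Member 1 S (a * (s ^ d) ^ j)) →
           ∃[ d ] (d < suc (suc n) × 1 ≤ a × 1 ≤ d × (∀ {j} → j < suc k → Member 1 S (a * (s ^ d) ^ j)))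
    step zero s d _ h = 1 , s<s z<s , 1≤a , s≤s z≤n , λ { z<s → h z<s }
    step (suc k) zero (suc d) _ h = 1 , s<s z<s , 1≤a , s≤s z≤n , h
    step (suc k) (suc zero) d _ h = 1 , s<s z<s , 1≤a , s≤s z≤n ,
      λ {j} j<k → subst (λ z → Member 1 S (a * z ^ j)) (^-zeroˡ d) (h j<k)
    step (suc k) s@(suc (suc _)) d 1≤d h = d , m<n⇒m<1+n d<1+n , 1≤a , 1≤d , h
      where
      x≤ax : ∀ a x → 1 ≤ a → x ≤ a * x
      x≤ax (suc a) x _ = m≤m+n x (a * x)
      d<1+n : d < suc n
      d<1+n = <-trans (n<s^n s d (s≤s (s≤s z≤n)))
        (≤-<-trans (≤-trans (≤-reflexive (sym (*-identityʳ (s ^ d)))) (x≤ax a _ 1≤a)) (member-< 1 S (h (s<s z<s))))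

hasAP? : ∀ {ℓ} k → Decidable (HasAP {ℓ} k)
hasAP? {ℓ} k S = map′ (λ { (v , _ , d , _ , p) → v , d , p }) (boundAP k S)
  (anyUpTo? (λ v → anyUpTo? (λ d → (1 ≤? d) ×-dec allUpTo? (λ j → member? 0 S (v + d * j)) k) (suc (suc ℓ))) (suc ℓ))

hasGP? : ∀ {n} k s → Decidable (HasGP {n} k s)
hasGP? {n} k s S = map′ (λ { (a , _ , d , _ , p) → a , d , p }) (boundGP k s S)
  (anyUpTo? (λ a → anyUpTo? (λ d → (1 ≤? a) ×-dec (1 ≤? d) ×-dec allUpTo? (λ j → member? 1 S (a * (s ^ d) ^ j)) k) (suc (suc n))) (suc (suc n)))

r : ℕ → ℕ → ℕ
r k ℓ = largest {ℓ} {APFree k} (λ S → ¬? (hasAP? k S))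

g : ℕ → ℕ → ℕ → ℕ
g k s n = largest {n} {GPFree k s} (λ S → ¬? (hasGP? k s S))

r⁻¹ : ℕ → ℕ → ℕ → Set
r⁻¹ k m ℓ = 1 ≤ ℓ × r k ℓ ≡ m

IsMin : (ℕ → Set) → ℕ → Set
IsMin A ℓ = A ℓ × (∀ ℓ′ → A ℓ′ → ℓ ≤ ℓ′)

-- Term k s m q : the m-th summand (1/s)^(min (r⁻¹ k m)) of the series is q.
-- An empty preimage contributes 0 (min ∅ = ∞); this only happens for k ≤ 2,
-- where for instance r 2 ℓ = 1 for every ℓ ≥ 1.
data Term (k s : ℕ) .{{_ : NonZero s}} (m : ℕ) : ℚ → Set where
  attained : ∀ {ℓ} → IsMin (r⁻¹ k m) ℓ → Term k s m ((+ 1 / s) ^ℚ ℓ)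
  empty    : (∀ ℓ → ¬ r⁻¹ k m ℓ) → Term k s m 0ℚ

partialSum : (ℕ → ℚ) → ℕ → ℚ
partialSum t zero    = 0ℚ
partialSum t (suc M) = partialSum t M ℚ.+ t (suc M)

record ℝ : Set where
  field
    seq    : ℕ → ℚ
    cauchy : ∀ ε → 0ℚ ℚ.< ε → ∃[ N ] (∀ m n → N ≤ m → N ≤ n → ℚ.∣ seq m ℚ.- seq n ∣ ℚ.< ε)
open ℝ public

infix 4 _≃_ _⟶_

_≃_ : ℝ → ℝ → Set
x ≃ y = ∀ ε → 0ℚ ℚ.< ε → ∃[ N ] (∀ n → N ≤ n → ℚ.∣ seq x n ℚ.- seq y n ∣ ℚ.< ε)

fromℚ : ℚ → ℝ
fromℚ q .seq _ = q
fromℚ q .cauchy ε 0<ε = 0 , λ _ _ _ _ → subst (ℚ._< ε) (sym (cong ℚ.∣_∣ (ℚ.+-inverseʳ q))) 0<ε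

Irrational : ℝ → Set
Irrational x = ∀ q → ¬ (x ≃ fromℚ q)

-- Lies between |q − x| < ε and |q − x| ≤ ε, hence yields the usual limit below.
Within : ℚ → ℚ → ℝ → Set
Within ε q x = ∃[ M ] (∀ m → M ≤ m → ℚ.∣ q ℚ.- seq x m ∣ ℚ.< ε)

_⟶_ : (ℕ → ℚ) → ℝ → Set
a ⟶ x = ∀ ε → 0ℚ ℚ.< ε → ∃[ N ] (∀ n → N ≤ n → Within ε (a n) x)

{-# OPTIONS --safe #-}
-- Multiplication by s splits the positive integers into chains b, bs, bs², … with s ∤ b, on which geometric
-- progressions with ratio a power of s become arithmetic progressions of exponents. Hence g(n) is the sum
-- of r(length of the chain of b inside {1,…,n}) over b, that is, g(n) = ∑_{j ≤ n} δ(v(j)), where v(j) is the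
-- exponent of j in its chain and δ(i) = r(i+1) − r(i) ∈ {0,1}. Counting by exponents gives
-- g(n)/n → (s − 1) ∑ᵢ δ(i) / s^(i+1), and δ(i) = 1 exactly when i + 1 is the least ℓ with r(ℓ) = r(i) + 1.
--
-- The δ(i) are the base-s digits of this sum, so if it is rational they are eventually periodic. Then r is
-- linear up to a bounded error, and by subadditivity a largest progression-free set in a long interval has
-- bounded gaps: finitely many of its translates cover the interval. Van der Waerden's theorem puts a
-- progression in one translate, hence in the set itself. Szemerédi's theorem is not needed.

module Submission where

open import Data.Bool using (Bool; true; false) renaming (_≟_ to _≟ᵇ_)
open import Data.Bool.Properties using (¬-not)
open import Data.Fin using (Fin; zero; suc; toℕ; fromℕ<; funToFin; finToFun)
open import Data.Fin.Properties using (any?; pigeonhole; finToFun-funToFin; toℕ<n; toℕ-fromℕ<; fromℕ<-injective) renaming (_≟_ to _≟ᶠ_; <-irrefl to <ᶠ-irrefl)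
open import Data.Fin.Subset using (Subset; _∈_; ∣_∣; ⊥)
open import Data.Fin.Subset.Properties using (∣⊥∣≡0; ∉⊥)
import Data.Integer as ℤ
import Data.Integer.Properties as ℤ
open import Data.List using (map; filter)
open import Data.List.Extrema.Nat using (xs≤max; argmax-sel)
open import Data.List.Membership.Propositional using () renaming (_∈_ to _∈ˡ_)
open import Data.List.Membership.Propositional.Properties using (∈-map⁺; ∈-++⁺ˡ; ∈-++⁺ʳ; ∈-map∘filter⁺; ∈-map∘filter⁻)
import Data.List.Relation.Unary.All as All
open import Data.List.Relation.Unary.Any using (here)
open import Data.Nat using (ℕ; zero; suc; pred; _+_; _^_; _∸_; _⊔_; _≤_; _<_; z≤n; s≤s; z<s; s<s; _≤?_; _<?_; _≟_; NonZero)
import Data.Nat as Nat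
open import Data.Nat.Divisibility using (_∣_; _∣?_; divides; n∣m*n; m∣m*n; ∣m+n∣m⇒∣n; >⇒∤; ∣n⇒∣m*n)
open import Data.Nat.DivMod using (m≡m%n+[m/n]*n; m%n<n)
open import Data.Nat.Properties hiding (_≤?_; _<?_; _≟_)
open import Data.Nat.Tactic.RingSolver using (solve-∀)
open import Data.Product using (∃-syntax; _×_; _,_; proj₁; proj₂)
open import Data.Rational using (ℚ; mkℚ; 0ℚ; toℚᵘ; *≤*; *<*)
import Data.Rational as ℚ
import Data.Rational.Properties as ℚ
open import Algebra.Properties.Group ℚ.+-0-group using (⁻¹-anti-homo-//; //-rightDividesˡ; //-rightDividesʳ)
open import Data.Rational.Unnormalised using (mkℚᵘ) renaming (_≃_ to _≃ᵘ_; *≤* to *≤*ᵘ; *<* to *<*ᵘ)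
import Data.Rational.Unnormalised as ℚᵘ
import Data.Rational.Unnormalised.Properties as ℚᵘ
open import Data.Sum using (_⊎_; inj₁; inj₂)
open import Data.Vec using ([]; _∷_; here; there)
open import Defs
open import Function using (_∘_; id)
open import Level using (0ℓ)
open import Relation.Binary.PropositionalEquality
open import Relation.Nullary using (¬_; ¬?; Dec; yes; no; contradiction)
open import Relation.Unary using (Pred; Decidable)

-- For k = 2 every nonempty interval has r = 1 and the limit is the rational (s - 1)/s, so
-- irrationality is claimed for 3 ≤ k only. From there on r is unbounded and the digit 1 occurs
-- infinitely often. This excludes terminating expansions, and with them the ambiguity 0111... =
-- 1000... that digits in {0, 1} would have for s = 2.
--
-- The order of choices makes van der Waerden's theorem sufficient. A progression-free set with a
-- gap of length G has at most r(x) + r(y) elements, x and y being the lengths left and right of the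
-- gap. When r is linear up to a bounded error, some G makes r(x + G + y) larger than this for all x
-- and y at once. So G, the number of colours, is fixed before the interval is chosen, and the
-- interval can be as long as the theorem demands for G colours.
--
-- Most of the work happens over ℕ, with denominators cleared. The limit L is the Cauchy sequence of
-- truncated expansions, and the density and the series are each compared with it.

-- Van der Waerden's theorem by colour focusing

module ColourFocusing where
  open Nat using (_*_)

  MonoAP : ∀ {c} → (ℕ → Fin c) → ℕ → ℕ → ℕ → Set
  MonoAP χ k v d = ∀ {j} → j < k → χ (v + d * j) ≡ χ v

  -- The first term past the progression is still below W.
  VanDerWaerden : ℕ → ℕ → ℕ → Set
  VanDerWaerden k c W = ∀ (χ : ℕ → Fin c) →
    ∃[ v ] ∃[ d ] (1 ≤ d × d < W × v + d * k < W × MonoAP χ k v d)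

  -- The point `focus` would be the next term of each of the `m` progressions. If it has the colour
  -- of one of them, that one grows to length k + 1; otherwise the family can be enlarged. As the
  -- colours are pairwise distinct, `m` cannot exceed `c`.
  record Focused {c} (χ : ℕ → Fin c) (k m W : ℕ) : Set where
    field
      focus        : ℕ
      focus<W      : focus < W
      start step   : Fin m → ℕ
      step-pos     : ∀ i → 1 ≤ step i
      step<W       : ∀ i → step i < W
      meets        : ∀ i → start i + step i * k ≡ focus
      mono         : ∀ i → MonoAP χ k (start i) (step i)
      injective    : ∀ {i j} → χ (start i) ≡ χ (start j) → i ≡ j

  Extended : ∀ {c} → (ℕ → Fin c) → ℕ → ℕ → Set
  Extended χ k W = ∃[ v ] ∃[ d ] (1 ≤ d × d < W × v + d * k < W × MonoAP χ (suc k) v d)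

  Focusing : ℕ → ℕ → ℕ → ℕ → Set
  Focusing k c m W = ∀ (χ : ℕ → Fin c) → Extended χ k W ⊎ Focused χ k m W

  block-offset : ∀ {b V x W} → b < V → x < W → b * W + x < V * W
  block-offset {b} {V} {x} {W} b<V x<W = begin-strict
    b * W + x  <⟨ +-monoʳ-< (b * W) x<W ⟩
    b * W + W  ≡⟨ +-comm (b * W) W ⟩
    suc b * W  ≤⟨ *-monoˡ-≤ W b<V ⟩
    V * W      ∎
    where open ≤-Reasoning

  Extended-shift : ∀ {c k W V b} {χ : ℕ → Fin c} → b < V →
                   Extended (λ x → χ (b * W + x)) k W → Extended χ k (V * W)
  Extended-shift {k = k} {W} {V} {b} {χ} b<V (v , d , 1≤d , d<W , end<W , mono) =
    b * W + v , d , 1≤d ,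
    ≤-<-trans (m≤n+m d (b * W)) (block-offset b<V d<W) ,
    subst (_< V * W) (sym (+-assoc (b * W) v (d * k))) (block-offset b<V end<W) ,
    λ {j} j<k → trans (cong χ (+-assoc (b * W) v (d * j))) (mono j<k)

  module _ {c k m W V : ℕ} (χ : ℕ → Fin c) (b D : ℕ) (1≤D : 1 ≤ D) (D<V : D < V) (end<V : b + D * k < V)
           (repeat : ∀ {j} → j < k → ∀ {x} → x < W → χ ((b + D * j) * W + x) ≡ χ (b * W + x))
           (F : Focused (λ x → χ (b * W + x)) k m W) where
    open Focused F

    private
      term : ∀ v d j → b * W + v + (D * W + d) * j ≡ (b + D * j) * W + (v + d * j)
      term v d j = identity b D W v d j
        where
        identity : ∀ b D W v d j → b * W + v + (D * W + d) * j ≡ (b + D * j) * W + (v + d * j)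
        identity = solve-∀

      new-term : ∀ j → b * W + focus + D * W * j ≡ (b + D * j) * W + focus
      new-term j = identity b D W focus j
        where
        identity : ∀ b D W f j → b * W + f + D * W * j ≡ (b + D * j) * W + f
        identity = solve-∀

      1≤W : 1 ≤ W
      1≤W = ≤-<-trans z≤n focus<W

      term<W : ∀ i {j} → j < k → start i + step i * j < W
      term<W i j<k = ≤-<-trans
        (≤-trans (+-monoʳ-≤ (start i) (*-monoʳ-≤ (step i) (<⇒≤ j<k))) (≤-reflexive (meets i))) focus<W

    -- The blocks `b + D * j` with j < k are coloured alike. An old progression of step d is spread
    -- diagonally over them, with step `D * W + d`; the copies of the old focus form one more, with
    -- step `D * W` and a colour that is new. All meet at the copy of the focus in block
    -- `b + D * k`.
    refocus : (∀ i → χ (b * W + focus) ≢ χ (b * W + start i)) → Focused χ k (suc m) (V * W)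
    refocus fresh = record
      { focus     = (b + D * k) * W + focus
      ; focus<W   = block-offset end<V focus<W
      ; start     = start′
      ; step      = step′
      ; step-pos  = λ { zero → *-mono-≤ 1≤D 1≤W ; (suc i) → ≤-trans (step-pos i) (m≤n+m _ (D * W)) }
      ; step<W    = λ { zero → subst (_< V * W) (+-identityʳ (D * W)) (block-offset D<V 1≤W)
                      ; (suc i) → block-offset D<V (step<W i) }
      ; meets     = λ { zero → new-term k
                      ; (suc i) → trans (term (start i) (step i) k) (cong ((b + D * k) * W +_) (meets i)) }
      ; mono      = λ { zero {j} j<k → trans (cong χ (new-term j)) (repeat j<k focus<W)
                      ; (suc i) {j} j<k → trans (cong χ (term (start i) (step i) j))
                                            (trans (repeat j<k (term<W i j<k)) (mono i j<k)) }
      ; injective = λ { {zero} {zero} _ → refl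
                      ; {zero} {suc j} eq → contradiction eq (fresh j)
                      ; {suc i} {zero} eq → contradiction (sym eq) (fresh i)
                      ; {suc i} {suc j} eq → cong suc (injective eq) }
      }
      where
      start′ step′ : Fin (suc m) → ℕ
      start′ zero    = b * W + focus
      start′ (suc i) = b * W + start i
      step′ zero    = D * W
      step′ (suc i) = D * W + step i

  extend-focused : ∀ {c k m W} {χ : ℕ → Fin c} (F : Focused χ k m W) →
    ∀ i → χ (Focused.focus F) ≡ χ (Focused.start F i) → Extended χ k W
  extend-focused {k = k} {W = W} {χ} F i eq =
    start i , step i , step-pos i , step<W i , subst (_< W) (sym (meets i)) focus<W , λ j<1+k → go (m≤n⇒m<n∨m≡n (≤-pred j<1+k))
    where
    open Focused F
    go : ∀ {j} → j < k ⊎ j ≡ k → χ (start i + step i * j) ≡ χ (start i)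
    go (inj₁ j<k)  = mono i j<k
    go (inj₂ refl) = trans (cong χ (meets i)) eq

  -- A block of `W` points has `c ^ W` possible colourings. With these as the colours of the blocks,
  -- the theorem for length `k` yields `k` equally spaced blocks with identical colouring, and a
  -- focused family in the first block is copied into the others.
  focusing-step : ∀ {k c m W V} → Focusing k c m W → VanDerWaerden k (c ^ W) V → Focusing k c (suc m) (V * W)
  focusing-step {k} {c} {m} {W} {V} foc vdw χ
    with vdw (λ b → funToFin (λ i → χ (b * W + toℕ {W} i)))
  ... | b , D , 1≤D , D<V , end<V , same = go (foc (λ x → χ (b * W + x)))
    where
    repeat : ∀ {j} → j < k → ∀ {x} → x < W → χ ((b + D * j) * W + x) ≡ χ (b * W + x)
    repeat {j} j<k {x} x<W = begin
      χ ((b + D * j) * W + x)                  ≡⟨ cong (λ y → χ ((b + D * j) * W + y)) (toℕ-fromℕ< x<W) ⟨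
      χ ((b + D * j) * W + toℕ (fromℕ< x<W))   ≡⟨ finToFun-funToFin (λ i → χ ((b + D * j) * W + toℕ i)) (fromℕ< x<W) ⟨
      finToFun {c} {W} (funToFin {W} (λ i → χ ((b + D * j) * W + toℕ i))) (fromℕ< x<W)
        ≡⟨ cong (λ h → finToFun {c} {W} h (fromℕ< x<W)) (same j<k) ⟩
      finToFun {c} {W} (funToFin {W} (λ i → χ (b * W + toℕ i))) (fromℕ< x<W)
        ≡⟨ finToFun-funToFin (λ i → χ (b * W + toℕ i)) (fromℕ< x<W) ⟩
      χ (b * W + toℕ (fromℕ< x<W))             ≡⟨ cong (λ y → χ (b * W + y)) (toℕ-fromℕ< x<W) ⟩
      χ (b * W + x)                            ∎
      where open ≡-Reasoning
    b<V : b < V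
    b<V = ≤-<-trans (m≤m+n b (D * k)) end<V
    go : Extended (λ x → χ (b * W + x)) k W ⊎ Focused (λ x → χ (b * W + x)) k m W →
         Extended χ k (V * W) ⊎ Focused χ k (suc m) (V * W)
    go (inj₁ ext) = inj₁ (Extended-shift b<V ext)
    go (inj₂ F) with any? (λ i → χ (b * W + Focused.focus F) ≟ᶠ χ (b * W + Focused.start F i))
    ... | yes (i , eq) = inj₁ (Extended-shift b<V (extend-focused F i eq))
    ... | no fresh = inj₂ (refocus χ b D 1≤D D<V end<V repeat F (λ i eq → fresh (i , eq)))

  -- The outer induction on `k` has to cover all numbers of colours at once, because each step of
  -- the inner induction on the size of the family appeals to length `k` with `c ^ W` colours.
  vanDerWaerden : ∀ k c → ∃[ W ] VanDerWaerden k c W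
  vanDerWaerden zero c = 2 , λ χ → 0 , 1 , s≤s z≤n , s<s z<s , z<s , λ ()
  vanDerWaerden (suc k) c with focusing (suc c)
    where
    focusing : ∀ m → ∃[ W ] Focusing k c m W
    focusing zero = 1 , λ χ → inj₂ (record
      { focus = 0 ; focus<W = z<s ; start = λ () ; step = λ () ; step-pos = λ () ; step<W = λ ()
      ; meets = λ () ; mono = λ () ; injective = λ { {()} } })
    focusing (suc m) =
      let W , foc = focusing m
          V , vdw = vanDerWaerden k (c ^ W)
      in V * W , focusing-step foc vdw
  -- `Extended` keeps the last of the k + 1 terms below `W`. The step is below `W` as well, so the
  -- term after the last is below `W + W`.
  ... | W , foc = W + W , λ χ → conclude χ (foc χ)
    where
    conclude : ∀ χ → Extended χ k W ⊎ Focused χ k (suc c) W →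
               ∃[ v ] ∃[ d ] (1 ≤ d × d < W + W × v + d * suc k < W + W × MonoAP χ (suc k) v d)
    conclude χ (inj₁ (v , d , 1≤d , d<W , end<W , mono)) =
      v , d , 1≤d , ≤-trans d<W (m≤m+n W W) ,
      subst (_< W + W) (sym (end v d k)) (+-mono-< end<W d<W) , mono
      where
      end : ∀ v d k → v + d * suc k ≡ v + d * k + d
      end = solve-∀
    conclude χ (inj₂ F) with pigeonhole ≤-refl (λ i → χ (Focused.start F i))
    ... | i , j , i<j , eq = contradiction i<j (<ᶠ-irrefl (Focused.injective F eq))

open ColourFocusing

-- Finite sums, and r and g as maxima over predicates on ℕ

module ExtremalSets where
  open Nat using (_*_)

  ∑ : (ℕ → ℕ) → ℕ → ℕ
  ∑ f zero    = 0
  ∑ f (suc n) = ∑ f n + f n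

  𝟙 : Bool → ℕ
  𝟙 true  = 1
  𝟙 false = 0

  size : (ℕ → Bool) → ℕ → ℕ
  size p = ∑ (𝟙 ∘ p)

  ∑-cong : ∀ {f h} n → (∀ {i} → i < n → f i ≡ h i) → ∑ f n ≡ ∑ h n
  ∑-cong zero    eq = refl
  ∑-cong (suc n) eq = cong₂ _+_ (∑-cong n (eq ∘ m<n⇒m<1+n)) (eq ≤-refl)

  ∑-mono : ∀ {f h} n → (∀ {i} → i < n → f i ≤ h i) → ∑ f n ≤ ∑ h n
  ∑-mono zero    le = z≤n
  ∑-mono (suc n) le = +-mono-≤ (∑-mono n (le ∘ m<n⇒m<1+n)) (le ≤-refl)

  ∑-split : ∀ f m n → ∑ f (m + n) ≡ ∑ f m + ∑ (λ i → f (m + i)) n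
  ∑-split f m zero    = trans (cong (∑ f) (+-identityʳ m)) (sym (+-identityʳ _))
  ∑-split f m (suc n) = begin
    ∑ f (m + suc n)                                 ≡⟨ cong (∑ f) (+-suc m n) ⟩
    ∑ f (m + n) + f (m + n)                         ≡⟨ cong (_+ f (m + n)) (∑-split f m n) ⟩
    ∑ f m + ∑ (λ i → f (m + i)) n + f (m + n)       ≡⟨ +-assoc (∑ f m) _ _ ⟩
    ∑ f m + (∑ (λ i → f (m + i)) n + f (m + n))     ∎
    where open ≡-Reasoning

  ∑-first : ∀ f n → ∑ f (suc n) ≡ f 0 + ∑ (f ∘ suc) n
  ∑-first f n = ∑-split f 1 n

  ∑-zero : ∀ {f} n → (∀ {i} → i < n → f i ≡ 0) → ∑ f n ≡ 0
  ∑-zero zero    eq = refl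
  ∑-zero (suc n) eq = cong₂ _+_ (∑-zero n (eq ∘ m<n⇒m<1+n)) (eq ≤-refl)

  ∑-≤-length : ∀ {f} n → (∀ {i} → i < n → f i ≤ 1) → ∑ f n ≤ n
  ∑-≤-length zero    le = z≤n
  ∑-≤-length (suc n) le = ≤-trans (+-mono-≤ (∑-≤-length n (le ∘ m<n⇒m<1+n)) (le ≤-refl)) (≤-reflexive (+-comm n 1))

  ∑-extend : ∀ {f m n} → m ≤ n → (∀ {i} → m ≤ i → f i ≡ 0) → ∑ f n ≡ ∑ f m
  ∑-extend {f} {m} {n} m≤n vanish with m≤n⇒∃[o]m+o≡n m≤n
  ... | e , refl = trans (∑-split f m e)
          (trans (cong (∑ f m +_) (∑-zero e (λ {i} _ → vanish (m≤m+n m i)))) (+-identityʳ _))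

  ∑-+ : ∀ f h n → ∑ (λ i → f i + h i) n ≡ ∑ f n + ∑ h n
  ∑-+ f h zero    = refl
  ∑-+ f h (suc n) = trans (cong (_+ (f n + h n)) (∑-+ f h n)) (+-exchange (∑ f n) (∑ h n) (f n) (h n))
    where
    +-exchange : ∀ a b c d → a + b + (c + d) ≡ (a + c) + (b + d)
    +-exchange = solve-∀

  ∑-*ˡ : ∀ c f n → ∑ (λ i → c * f i) n ≡ c * ∑ f n
  ∑-*ˡ c f zero    = sym (*-zeroʳ c)
  ∑-*ˡ c f (suc n) = trans (cong (_+ c * f n) (∑-*ˡ c f n)) (sym (*-distribˡ-+ c (∑ f n) (f n)))

  𝟙≤1 : ∀ b → 𝟙 b ≤ 1
  𝟙≤1 true  = ≤-refl
  𝟙≤1 false = z≤n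

  bit : ∀ {n} → Subset n → ℕ → Bool
  bit []      _       = false
  bit (x ∷ S) zero    = x
  bit (x ∷ S) (suc i) = bit S i

  fromBits : ∀ n → (ℕ → Bool) → Subset n
  fromBits zero    p = []
  fromBits (suc n) p = p 0 ∷ fromBits n (p ∘ suc)

  ∣∣≡size-bit : ∀ {n} (S : Subset n) → ∣ S ∣ ≡ size (bit S) n
  ∣∣≡size-bit []                = refl
  ∣∣≡size-bit {suc n} (true  ∷ S) = trans (cong suc (∣∣≡size-bit S)) (sym (∑-first (𝟙 ∘ bit (true ∷ S)) n))
  ∣∣≡size-bit {suc n} (false ∷ S) = trans (∣∣≡size-bit S) (sym (∑-first (𝟙 ∘ bit (false ∷ S)) n))

  ∈⇒bit : ∀ {n} {S : Subset n} {i} → i ∈ S → bit S (toℕ i) ≡ true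
  ∈⇒bit here      = refl
  ∈⇒bit (there p) = ∈⇒bit p

  bit⇒∈ : ∀ {n} (S : Subset n) x → bit S x ≡ true → ∃[ i ] (toℕ i ≡ x × i ∈ S)
  bit⇒∈ (true ∷ S) zero    refl = zero , refl , here
  bit⇒∈ (_ ∷ S)    (suc x) eq   = let i , i≡x , i∈S = bit⇒∈ S x eq in suc i , cong suc i≡x , there i∈S

  Member⇒bit : ∀ {n} c (S : Subset n) {x} → Member c S x → ∃[ i ] (i < n × c + i ≡ x × bit S i ≡ true)
  Member⇒bit c S (i , eq , i∈S) = toℕ i , toℕ<n i , eq , ∈⇒bit i∈S

  bit⇒Member : ∀ {n} c (S : Subset n) {i} → bit S i ≡ true → Member c S (c + i)
  bit⇒Member c S eq = let i , i≡x , i∈S = bit⇒∈ S _ eq in i , cong (c +_) i≡x , i∈S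

  bit-fromBits : ∀ {n} p {i} → i < n → bit (fromBits n p) i ≡ p i
  bit-fromBits p z<s               = refl
  bit-fromBits p (s<s i<n@(s≤s _)) = bit-fromBits (p ∘ suc) i<n

  ∣fromBits∣ : ∀ n p → ∣ fromBits n p ∣ ≡ size p n
  ∣fromBits∣ n p = trans (∣∣≡size-bit (fromBits n p)) (∑-cong n (λ i<n → cong 𝟙 (bit-fromBits p i<n)))

  ∈-subsets : ∀ {n} (S : Subset n) → S ∈ˡ subsets n
  ∈-subsets []          = here refl
  ∈-subsets (true  ∷ S) = ∈-++⁺ˡ (∈-map⁺ (true ∷_) (∈-subsets S))
  ∈-subsets {suc n} (false ∷ S) = ∈-++⁺ʳ (map (true ∷_) (subsets n)) (∈-map⁺ (false ∷_) (∈-subsets S))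

  module _ {n} {P : Pred (Subset n) 0ℓ} (P? : Decidable P) where

    largest-upper : ∀ {S} → P S → ∣ S ∣ ≤ largest P?
    largest-upper {S} pS = All.lookup (xs≤max 0 (map ∣_∣ (filter P? (subsets n))))
      (∈-map∘filter⁺ ∣_∣ P? (S , ∈-subsets S , refl , pS))

    largest-attained : P ⊥ → ∃[ S ] (P S × ∣ S ∣ ≡ largest P?)
    largest-attained p⊥ with argmax-sel id 0 (map ∣_∣ (filter P? (subsets n)))
    ... | inj₁ eq = ⊥ , p⊥ , trans (∣⊥∣≡0 n) (sym eq)
    ... | inj₂ ∈  = let S , _ , eq , pS = ∈-map∘filter⁻ ∣_∣ P? {xs = subsets n} ∈ in S , pS , sym eq

  -- Being an upper bound that is attained determines the maximum. Through this property `g` is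
  -- later identified with a sum that is not defined by enumerating subsets.
  IsLargest : (Q : (ℕ → Bool) → Set) (w : (ℕ → Bool) → ℕ) (m : ℕ) → Set
  IsLargest Q w m = (∀ p → Q p → w p ≤ m) × ∃[ p ] (Q p × w p ≡ m)

  IsLargest-unique : ∀ {Q w m n} → IsLargest Q w m → IsLargest Q w n → m ≡ n
  IsLargest-unique (upper₁ , p₁ , q₁ , eq₁) (upper₂ , p₂ , q₂ , eq₂) =
    ≤-antisym (subst (_≤ _) eq₁ (upper₂ p₁ q₁)) (subst (_≤ _) eq₂ (upper₁ p₂ q₂))

  -- Predicates on all of ℕ with a cutoff `ℓ` replace subsets of `Fin ℓ`, so that translates, pieces
  -- and sets of different lengths share one type.
  ContainsAP : ℕ → ℕ → (ℕ → Bool) → Set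
  ContainsAP k ℓ p = ∃[ v ] ∃[ d ] (1 ≤ d × (∀ {j} → j < k → v + d * j < ℓ × p (v + d * j) ≡ true))

  LargestAPFree : ℕ → ℕ → ℕ → Set
  LargestAPFree k ℓ = IsLargest (λ p → ¬ ContainsAP k ℓ p) (λ p → size p ℓ)

  -- Positivity of `k` makes the empty set progression-free, hence the maximum is attained. For k =
  -- 0 no set is progression-free, and `largest` returns only its default 0.
  r-largest : ∀ {k} → 1 ≤ k → ∀ ℓ → LargestAPFree k ℓ (r k ℓ)
  r-largest {k} 1≤k ℓ = upper , attained-by (largest-attained AP? (λ { (_ , _ , _ , h) → ∉⊥ (proj₂ (proj₂ (h 1≤k))) }))
    where
    AP? : Decidable (APFree {ℓ} k)
    AP? S = ¬? (hasAP? k S)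
    upper : ∀ p → ¬ ContainsAP k ℓ p → size p ℓ ≤ r k ℓ
    upper p free = subst (_≤ r k ℓ) (∣fromBits∣ ℓ p) (largest-upper AP? λ { (v , d , 1≤d , h) →
        free (v , d , 1≤d , λ j<k → transfer (Member⇒bit 0 (fromBits ℓ p) (h j<k))) })
      where
      transfer : ∀ {x} → ∃[ i ] (i < ℓ × i ≡ x × bit (fromBits ℓ p) i ≡ true) → x < ℓ × p x ≡ true
      transfer (i , i<ℓ , refl , eq) = i<ℓ , trans (sym (bit-fromBits p i<ℓ)) eq
    attained-by : ∃[ S ] (APFree k S × ∣ S ∣ ≡ r k ℓ) → ∃[ p ] (¬ ContainsAP k ℓ p × size p ℓ ≡ r k ℓ)
    attained-by (S , free , eq) =
      bit S , (λ { (v , d , 1≤d , h) → free (v , d , 1≤d , λ j<k → bit⇒Member 0 S (proj₂ (h j<k))) }) ,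
      trans (sym (∣∣≡size-bit S)) eq

  ContainsGP : ℕ → ℕ → ℕ → (ℕ → Bool) → Set
  ContainsGP k s n p = ∃[ a ] ∃[ d ] (1 ≤ a × 1 ≤ d × (∀ {j} → j < k → a * (s ^ d) ^ j ≤ n × p (a * (s ^ d) ^ j) ≡ true))

  LargestGPFree : ℕ → ℕ → ℕ → ℕ → Set
  LargestGPFree k s n = IsLargest (λ p → ¬ ContainsGP k s n p) (λ p → size (p ∘ suc) n)

  g-largest : ∀ {k} → 1 ≤ k → ∀ s n → LargestGPFree k s n (g k s n)
  g-largest {k} 1≤k s n = upper , attained-by (largest-attained GP? (λ { (_ , _ , _ , _ , h) → ∉⊥ (proj₂ (proj₂ (h 1≤k))) }))
    where
    GP? : Decidable (GPFree {n} k s)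
    GP? S = ¬? (hasGP? k s S)
    upper : ∀ p → ¬ ContainsGP k s n p → size (p ∘ suc) n ≤ g k s n
    upper p free = subst (_≤ g k s n) (∣fromBits∣ n (p ∘ suc)) (largest-upper GP? λ { (a , d , 1≤a , 1≤d , h) →
        free (a , d , 1≤a , 1≤d , λ j<k → transfer (Member⇒bit 1 (fromBits n (p ∘ suc)) (h j<k))) })
      where
      transfer : ∀ {x} → ∃[ i ] (i < n × suc i ≡ x × bit (fromBits n (p ∘ suc)) i ≡ true) → x ≤ n × p x ≡ true
      transfer (i , i<n , refl , eq) = i<n , trans (sym (bit-fromBits (p ∘ suc) i<n)) eq
    attained-by : ∃[ S ] (GPFree k s S × ∣ S ∣ ≡ g k s n) → ∃[ p ] (¬ ContainsGP k s n p × size (p ∘ suc) n ≡ g k s n)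
    attained-by (S , free , eq) =
      member , (λ { (a , d , 1≤a , 1≤d , h) → free (a , d , 1≤a , 1≤d , λ j<k → transfer _ (proj₂ (h j<k))) }) ,
      trans (sym (∣∣≡size-bit S)) eq
      where
      member : ℕ → Bool
      member zero    = false
      member (suc i) = bit S i
      transfer : ∀ x → member x ≡ true → Member 1 S x
      transfer (suc i) eq = bit⇒Member 1 S eq

open ExtremalSets

-- Growth of r: subadditivity, unboundedness, no periodic increments

module ProgressionFreeSets where
  open Nat using (_*_; _/_; _%_)

  size≤ : ∀ p n → size p n ≤ n
  size≤ p n = ∑-≤-length n (λ {i} _ → 𝟙≤1 (p i))

  module APFreeSize (k : ℕ) (R : ℕ → ℕ) (largest : ∀ ℓ → LargestAPFree k ℓ (R ℓ)) where

    upper : ∀ {ℓ p} → ¬ ContainsAP k ℓ p → size p ℓ ≤ R ℓ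
    upper {ℓ} {p} = proj₁ (largest ℓ) p

    R≤ : ∀ ℓ → R ℓ ≤ ℓ
    R≤ ℓ = let p , _ , eq = proj₂ (largest ℓ) in subst (_≤ ℓ) eq (size≤ p ℓ)

    R-0 : R 0 ≡ 0
    R-0 = n≤0⇒n≡0 (R≤ 0)

    interval≤R : ∀ {ℓ p} a n → ¬ ContainsAP k ℓ p → a + n ≤ ℓ → size (λ i → p (a + i)) n ≤ R n
    interval≤R {ℓ} {p} a n free a+n≤ℓ = upper λ { (v , d , 1≤d , h) → free (a + v , d , 1≤d , λ {j} j<k →
        let v+dj<n , eq = h j<k
            re = +-assoc a v (d * j)
        in ≤-trans (≤-reflexive (cong suc re)) (≤-trans (+-monoʳ-< a v+dj<n) a+n≤ℓ) ,
           trans (cong p re) eq) }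

    R-subadditive : ∀ a b → R (a + b) ≤ R a + R b
    R-subadditive a b with proj₂ (largest (a + b))
    ... | p , free , eq = begin
      R (a + b)                            ≡⟨ eq ⟨
      size p (a + b)                         ≡⟨ ∑-split (𝟙 ∘ p) a b ⟩
      size p a + size (λ i → p (a + i)) b    ≤⟨ +-mono-≤ (interval≤R {p = p} 0 a free (m≤m+n a b)) (interval≤R {p = p} a b free ≤-refl) ⟩
      R a + R b                          ∎
      where open ≤-Reasoning

    R-step≤1 : ∀ ℓ → R (suc ℓ) ≤ suc (R ℓ)
    R-step≤1 ℓ = begin
      R (1 + ℓ)     ≤⟨ R-subadditive 1 ℓ ⟩
      R 1 + R ℓ   ≤⟨ +-monoˡ-≤ (R ℓ) (R≤ 1) ⟩
      suc (R ℓ)     ∎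
      where open ≤-Reasoning

    R-step : ∀ ℓ → R ℓ ≤ R (suc ℓ)
    R-step ℓ with proj₂ (largest ℓ)
    ... | p , free , eq = begin
      R ℓ                        ≡⟨ eq ⟨
      size p ℓ                     ≡⟨ ∑-cong ℓ (λ {i} i<ℓ → cong 𝟙 (sym (inside i i<ℓ))) ⟩
      size p′ ℓ                    ≤⟨ m≤m+n (size p′ ℓ) (𝟙 (p′ ℓ)) ⟩
      size p′ (suc ℓ)              ≤⟨ upper {suc ℓ} {p′} (λ { (v , d , 1≤d , h) → free (v , d , 1≤d , λ j<k → p′-true _ (proj₂ (h j<k))) }) ⟩
      R (suc ℓ)                  ∎
      where
      open ≤-Reasoning
      -- The predicate `p` is arbitrary from `ℓ` on and must be cut off there before the interval
      -- grows.
      p′ : ℕ → Bool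
      p′ i with i <? ℓ
      ... | yes _ = p i
      ... | no _  = false
      inside : ∀ i → i < ℓ → p′ i ≡ p i
      inside i i<ℓ with i <? ℓ
      ... | yes _  = refl
      ... | no i≮ℓ = contradiction i<ℓ i≮ℓ
      p′-true : ∀ i → p′ i ≡ true → i < ℓ × p i ≡ true
      p′-true i eq with i <? ℓ
      ... | yes i<ℓ = i<ℓ , eq

    R-mono : ∀ {a b} → a ≤ b → R a ≤ R b
    R-mono {a} a≤b with m≤n⇒∃[o]m+o≡n a≤b
    ... | e , refl = go e
      where
      go : ∀ e → R a ≤ R (a + e)
      go zero    = ≤-reflexive (cong (R) (sym (+-identityʳ a)))
      go (suc e) = ≤-trans (go e) (≤-trans (R-step (a + e)) (≤-reflexive (cong (R) (sym (+-suc a e)))))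

    R-1 : 2 ≤ k → R 1 ≡ 1
    R-1 2≤k = ≤-antisym (R≤ 1) (upper {1} {λ _ → true} λ { (v , d , 1≤d , h) →
      <⇒≱ (proj₁ (h 2≤k)) (≤-trans 1≤d (≤-trans (≤-reflexive (sym (*-identityʳ d))) (m≤n+m (d * 1) v))) })

    -- Any two elements form a progression of length 2. The scan `go` carries either emptiness so
    -- far or one element found, which then rules out a second.
    R≤1 : k ≡ 2 → ∀ ℓ → R ℓ ≤ 1
    R≤1 refl ℓ with proj₂ (largest ℓ)
    ... | p , free , eq = subst (_≤ 1) eq (proj₁ (go ℓ ≤-refl))
      where
      distinct : ∀ {x y} → x < y → y < ℓ → p x ≡ true → ¬ p y ≡ true
      distinct {x} {y} x<y y<ℓ px py with m≤n⇒∃[o]m+o≡n x<y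
      ... | e , refl = free (x , suc e , s≤s z≤n , λ where
        z<s       → ≤-<-trans (≤-reflexive e*0) (<-trans x<y y<ℓ) , trans (cong p e*0) px
        (s<s z<s) → ≤-trans (s≤s (≤-reflexive e*1)) y<ℓ , trans (cong p e*1) py)
        where
        e*0 : x + suc e * 0 ≡ x
        e*0 = trans (cong (x +_) (*-zeroʳ e)) (+-identityʳ x)
        e*1 : x + suc e * 1 ≡ suc x + e
        e*1 = trans (cong (x +_) (*-identityʳ (suc e))) (+-suc x e)
      go : ∀ n → n ≤ ℓ → size p n ≤ 1 × (size p n ≡ 0 ⊎ ∃[ x ] (x < n × p x ≡ true))
      go zero    _   = z≤n , inj₁ refl
      go (suc n) n<ℓ with go n (<⇒≤ n<ℓ) | p n in pn
      ... | le , inj₁ zer | true            = ≤-reflexive (cong (_+ 1) zer) , inj₂ (n , ≤-refl , pn)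
      ... | le , inj₁ zer | false           = ≤-trans (≤-reflexive (+-identityʳ _)) le , inj₁ (trans (+-identityʳ _) zer)
      ... | le , inj₂ (x , x<n , px) | true = contradiction pn (distinct x<n n<ℓ px)
      ... | le , inj₂ (x , x<n , px) | false = ≤-trans (≤-reflexive (+-identityʳ _)) le , inj₂ (x , m<n⇒m<1+n x<n , px)

    module _ (3≤k : 3 ≤ k) where

      -- The point 2ℓ can be added to a largest set below ℓ. The growth obtained is merely
      -- logarithmic, but it gives the unboundedness on which infinitely many digits 1 and a
      -- positive gain per period rest.
      R-grows : ∀ ℓ → suc (R ℓ) ≤ R (suc (ℓ + ℓ))
      R-grows ℓ with proj₂ (largest ℓ)
      ... | p , free , eq = begin
        suc (R ℓ)                           ≡⟨ cong suc eq ⟨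
        suc (size p ℓ)                        ≡⟨ +-comm 1 (size p ℓ) ⟩
        size p ℓ + 1                          ≡⟨ cong₂ _+_ (∑-cong ℓ (λ {i} i<ℓ → cong 𝟙 (sym (old i i<ℓ)))) (cong 𝟙 (sym new)) ⟩
        size p′ ℓ + 𝟙 (p′ (ℓ + ℓ))            ≤⟨ +-monoˡ-≤ (𝟙 (p′ (ℓ + ℓ))) (≤-trans (m≤m+n (size p′ ℓ) _) (≤-reflexive (sym (∑-split (𝟙 ∘ p′) ℓ ℓ)))) ⟩
        size p′ (suc (ℓ + ℓ))                 ≤⟨ upper {suc (ℓ + ℓ)} {p′} (λ { (v , d , 1≤d , h) → free′ v d 1≤d h }) ⟩
        R (suc (ℓ + ℓ))                     ∎
        where
        open ≤-Reasoning
        p′ : ℕ → Bool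
        p′ i with i <? ℓ | i ≟ ℓ + ℓ
        ... | yes _ | _     = p i
        ... | no _  | yes _ = true
        ... | no _  | no _  = false
        old : ∀ i → i < ℓ → p′ i ≡ p i
        old i i<ℓ with i <? ℓ
        ... | yes _  = refl
        ... | no i≮ℓ = contradiction i<ℓ i≮ℓ
        new : p′ (ℓ + ℓ) ≡ true
        new with ℓ + ℓ <? ℓ | ℓ + ℓ ≟ ℓ + ℓ
        ... | yes 2ℓ<ℓ | _ = contradiction 2ℓ<ℓ (m+n≮m ℓ ℓ)
        ... | no _ | yes _ = refl
        ... | no _ | no ≢  = contradiction refl ≢
        p′-true : ∀ i → p′ i ≡ true → (i < ℓ × p i ≡ true) ⊎ i ≡ ℓ + ℓ
        p′-true i eq with i <? ℓ | i ≟ ℓ + ℓ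
        ... | yes i<ℓ | _      = inj₁ (i<ℓ , eq)
        ... | no _    | yes i≡ = inj₂ i≡
        -- A progression through 2ℓ with two smaller terms x < y would need 2ℓ − y = y − x,
        -- but y < ℓ.
        free′ : ∀ v d → 1 ≤ d → (∀ {j} → j < k → v + d * j < suc (ℓ + ℓ) × p′ (v + d * j) ≡ true) → _
        free′ v d 1≤d h = free (v , d , 1≤d , λ {j} j<k → small j<k (p′-true _ (proj₂ (h j<k))))
          where
          term<ℓ : ∀ {j} → suc j < k → v + d * j < ℓ
          term<ℓ {j} j<k with p′-true _ (proj₂ (h (<-trans ≤-refl j<k)))
          ... | inj₁ (lt , _) = lt
          ... | inj₂ eq₂ = contradiction (proj₁ (h j<k)) (≤⇒≯ (begin
            suc (ℓ + ℓ)       ≡⟨ cong suc eq₂ ⟨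
            suc (v + d * j)   ≤⟨ +-monoˡ-≤ (v + d * j) 1≤d ⟩
            d + (v + d * j)   ≡⟨ rearrange v d j ⟩
            v + d * suc j     ∎))
            where
            rearrange : ∀ v d j → d + (v + d * j) ≡ v + d * suc j
            rearrange = solve-∀
          small : ∀ {j} → j < k → (v + d * j < ℓ × p (v + d * j) ≡ true) ⊎ v + d * j ≡ ℓ + ℓ →
                  v + d * j < ℓ × p (v + d * j) ≡ true
          small j<k (inj₁ ok) = ok
          small {zero} j<k (inj₂ eq₂) = contradiction eq₂ (<⇒≢ (≤-trans (term<ℓ (≤-trans (s≤s (s≤s z≤n)) 3≤k)) (m≤m+n ℓ ℓ)))
          -- The difference `d` is at most the second term `v + d * 1`. As `3 ≤ k`, this term is not
          -- the last one, hence it is below `ℓ`, as is the term before 2ℓ.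
          small {suc j} j<k (inj₂ eq₂) = contradiction eq₂ (<⇒≢ (begin-strict
            v + d * suc j          ≡⟨ rearrange v d j ⟩
            v + d * j + d          ≤⟨ +-monoʳ-≤ (v + d * j) (≤-trans (≤-reflexive (sym (*-identityʳ d))) (m≤n+m (d * 1) v)) ⟩
            v + d * j + (v + d * 1) <⟨ +-mono-< (term<ℓ j<k) (term<ℓ 3≤k) ⟩
            ℓ + ℓ                  ∎))
            where
            rearrange : ∀ v d j → v + d * suc j ≡ v + d * j + d
            rearrange = solve-∀

      R-unbounded : ∀ m → ∃[ ℓ ] m ≤ R ℓ
      R-unbounded zero    = 0 , z≤n
      R-unbounded (suc m) = let ℓ , m≤r = R-unbounded m in suc (ℓ + ℓ) , ≤-trans (s≤s m≤r) (R-grows ℓ)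

      -- Such a gain forces every interval of length G to meet a largest set. Colour x by the distance
      -- to the next element of the set: a monochromatic progression is a translate of one in the set.
      no-uniform-gain : ∀ G → 1 ≤ G → ¬ (∀ x y → R x + R y < R (x + G + y))
      no-uniform-gain G@(suc _) _ gain with vanDerWaerden k G
      -- The extra `G` leaves room for the next element of the set after each of the `W` coloured
      -- points.
      ... | W , vdw with proj₂ (largest (W + G))
      ...   | p , free , eq = monochromatic (vdw χ)
        where
        open ≤-Reasoning
        hit : ∀ x → x < W → ∃[ i ] p (x + toℕ {G} i) ≡ true
        hit x x<W with any? (λ i → p (x + toℕ {G} i) ≟ᵇ true)
        ... | yes found = found
        ... | no none with m≤n⇒∃[o]m+o≡n (<⇒≤ x<W)
        -- Here `x + y` is `W`. A gap of length `G` at `x` leaves two progression-free pieces of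
        -- lengths `x` and `y`, too small together for a set of size `R (x + G + y)`.
        ...   | y , refl = contradiction (gain x y) (≤⇒≯ (begin
          R (x + G + y)       ≡⟨ cong (R) (swap x G y) ⟩
          R (x + y + G)       ≡⟨ eq ⟨
          size p (x + y + G)    ≡⟨ cong (size p) (sym (swap x G y)) ⟩
          size p (x + G + y)    ≡⟨ ∑-split (𝟙 ∘ p) (x + G) y ⟩
          size p (x + G) + size (λ i → p (x + G + i)) y
            ≡⟨ cong (_+ size (λ i → p (x + G + i)) y) (trans (∑-split (𝟙 ∘ p) x G) (trans (cong (size p x +_) gap) (+-identityʳ _))) ⟩
          size p x + size (λ i → p (x + G + i)) y
            ≤⟨ +-mono-≤ (interval≤R {p = p} 0 x free (≤-trans (m≤m+n x y) (m≤m+n _ G)))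
                        (interval≤R {p = p} (x + G) y free (≤-reflexive (swap x G y))) ⟩
          R x + R y         ∎))
          where
          swap : ∀ x G y → x + G + y ≡ x + y + G
          swap = solve-∀
          gap : size (λ i → p (x + i)) G ≡ 0
          gap = ∑-zero G (λ {i} i<G → cong 𝟙 (¬-not λ eq₂ → none (fromℕ< i<G , trans (cong (λ z → p (x + z)) (toℕ-fromℕ< i<G)) eq₂)))
        χ : ℕ → Fin G
        χ x with x <? W
        ... | yes x<W = proj₁ (hit x x<W)
        ... | no _    = zero
        χ-hit : ∀ {x} → x < W → p (x + toℕ (χ x)) ≡ true
        χ-hit {x} x<W with x <? W
        ... | yes x<W′ = proj₂ (hit x x<W′)
        ... | no x≮W = contradiction x<W x≮W
        monochromatic : ¬ (∃[ v ] ∃[ d ] (1 ≤ d × d < W × v + d * k < W × MonoAP χ k v d))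
        monochromatic (v , d , 1≤d , _ , end<W , mono) = free (v + toℕ (χ v) , d , 1≤d , λ {j} j<k →
          let x<W = ≤-<-trans (+-monoʳ-≤ v (*-monoʳ-≤ d (<⇒≤ j<k))) end<W
              re : v + toℕ (χ v) + d * j ≡ v + d * j + toℕ (χ (v + d * j))
              re = trans (swap v (toℕ (χ v)) (d * j)) (cong (λ c → v + d * j + toℕ c) (sym (mono j<k)))
          in subst (_< W + G) (sym re) (+-mono-< x<W (toℕ<n (χ (v + d * j)))) ,
             trans (cong p re) (χ-hit x<W))
          where
          swap : ∀ x G y → x + G + y ≡ x + y + G
          swap = solve-∀

      -- Periodic increments make R linear up to a bounded error, so a long enough gap always pays off.
      R-not-periodic : ∀ n P c → 1 ≤ P → ¬ (∀ ℓ → n ≤ ℓ → R (ℓ + P) ≡ R ℓ + c)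
      R-not-periodic n P@(suc _) c _ periodic = no-uniform-gain G 1≤G gain
        where
        open ≤-Reasoning
        iterate : ∀ a → R (n + a * P) ≡ R n + a * c
        iterate zero    = trans (cong R (+-identityʳ n)) (sym (+-identityʳ (R n)))
        iterate (suc a) = begin-equality
          R (n + (P + a * P))   ≡⟨ cong R (re n P (a * P)) ⟩
          R (n + a * P + P)     ≡⟨ periodic (n + a * P) (m≤m+n n _) ⟩
          R (n + a * P) + c     ≡⟨ cong (_+ c) (iterate a) ⟩
          R n + a * c + c       ≡⟨ re (R n) c (a * c) ⟨
          R n + (c + a * c)     ∎
          where
          re : ∀ x y z → x + (y + z) ≡ x + z + y
          re = solve-∀
        linear : ∀ x → R x ≤ R n + suc (x / P) * c
        linear x = ≤-trans (R-mono x≤) (≤-reflexive (iterate (suc (x / P))))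
          where
          x≤ : x ≤ n + suc (x / P) * P
          x≤ = begin
            x                      ≡⟨ m≡m%n+[m/n]*n x P ⟩
            x % P + x / P * P      ≤⟨ +-monoˡ-≤ (x / P * P) (<⇒≤ (m%n<n x P)) ⟩
            suc (x / P) * P        ≤⟨ m≤n+m _ n ⟩
            n + suc (x / P) * P    ∎
        -- With c = 0 the estimate `linear` would bound `R`.
        1≤c : 1 ≤ c
        1≤c = n≢0⇒n>0 λ { refl →
          let ℓ , big = R-unbounded (suc (R n))
          in <⇒≱ big (≤-trans (linear ℓ) (≤-reflexive (trans (cong (R n +_) (*-zeroʳ (suc (ℓ / P)))) (+-identityʳ _)))) }
        -- By `linear`, `R x` and `R y` exceed their shares `x / P * c` and `y / P * c` by at most
        -- `R n + c` each. The gap contributes `e` full periods, each worth `c ≥ 1`, so `e` is one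
        -- more than both errors together; the summand `n` in `G` covers the stretch before
        -- periodicity sets in.
        e : ℕ
        e = suc (R n + c + (R n + c))
        G : ℕ
        G = n + e * P
        1≤G : 1 ≤ G
        1≤G = ≤-trans (*-mono-≤ {1} {e} {1} {P} (s≤s z≤n) (s≤s z≤n)) (m≤n+m _ n)
        gain : ∀ x y → R x + R y < R (x + G + y)
        gain x y = begin-strict
          R x + R y
            ≤⟨ +-mono-≤ (linear x) (linear y) ⟩
          (R n + (c + x / P * c)) + (R n + (c + y / P * c))
            ≡⟨ re₁ (R n) c (x / P) (y / P) ⟩
          (R n + c + (R n + c)) + (x / P + y / P) * c
            <⟨ +-monoˡ-< ((x / P + y / P) * c) {R n + c + (R n + c)} {e} ≤-refl ⟩
          e + (x / P + y / P) * c
            ≤⟨ +-monoˡ-≤ ((x / P + y / P) * c) (≤-trans (≤-reflexive (sym (*-identityʳ e))) (*-monoʳ-≤ e 1≤c)) ⟩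
          e * c + (x / P + y / P) * c
            ≤⟨ m≤n+m _ (R n) ⟩
          R n + (e * c + (x / P + y / P) * c)
            ≡⟨ cong (R n +_) (sym (*-distribʳ-+ c e _)) ⟩
          R n + (e + (x / P + y / P)) * c
            ≡⟨ iterate (e + (x / P + y / P)) ⟨
          R (n + (e + (x / P + y / P)) * P)
            ≤⟨ R-mono (≤-trans (≤-reflexive (re₂ n e (x / P) (y / P) P)) (+-mono-≤ (+-monoˡ-≤ G (quot x)) (quot y))) ⟩
          R (x + G + y) ∎
          where
          quot : ∀ z → z / P * P ≤ z
          quot z = ≤-trans (m≤n+m (z / P * P) (z % P)) (≤-reflexive (sym (m≡m%n+[m/n]*n z P)))
          re₁ : ∀ R c a b → (R + (c + a * c)) + (R + (c + b * c)) ≡ (R + c + (R + c)) + (a + b) * c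
          re₁ = solve-∀
          re₂ : ∀ n e a b P → n + (e + (a + b)) * P ≡ a * P + (n + e * P) + b * P
          re₂ = solve-∀

open ProgressionFreeSets

-- Chains under multiplication by s, and g as a sum of digits

module GeometricChains where
  open Nat using (_*_; _/_; _%_)

  module Chain (s : ℕ) .{{_ : NonZero s}} (2≤s : 2 ≤ s) where

    n<s^n : ∀ n → n < s ^ n
    n<s^n zero    = z<s
    n<s^n (suc n) = ≤-<-trans (n<s^n n) (^-monoʳ-< s 2≤s {n} {suc n} ≤-refl)

    n<b*s^n : ∀ {b} n → 1 ≤ b → n < b * s ^ n
    n<b*s^n {b} n 1≤b = <-≤-trans (n<s^n n) (≤-trans (≤-reflexive (sym (*-identityˡ (s ^ n)))) (*-monoˡ-≤ (s ^ n) 1≤b))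

    -- This marks the chain starts. It is not the valuation, which is called `exponent`.
    ν : ℕ → ℕ
    ν j with s ∣? j
    ... | yes _ = 0
    ... | no _  = 1

    ν-multiple : ∀ {j} → s ∣ j → ν j ≡ 0
    ν-multiple {j} s∣j with s ∣? j
    ... | yes _  = refl
    ... | no s∤j = contradiction s∣j s∤j

    ν-other : ∀ {j} → ¬ s ∣ j → ν j ≡ 1
    ν-other {j} s∤j with s ∣? j
    ... | yes s∣j = contradiction s∣j s∤j
    ... | no _    = refl

    private
      -- Induction along n = q s + t with t < s: the number last reached is a multiple of `s`
      -- exactly when `t` is 0, and the one before it then has remainder s - 1.
      split-qt : ∀ f q t → t < s →
        ∑ (f ∘ suc) (q * s + t) ≡ ∑ (λ j → ν (suc j) * f (suc j)) (q * s + t) + ∑ (λ j → f (s * suc j)) q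
      split-qt f zero zero _ = refl
      split-qt f (suc q) zero _ = begin
        ∑ (f ∘ suc) (suc q * s + 0)      ≡⟨ cong (∑ (f ∘ suc)) last ⟩
        ∑ (f ∘ suc) x + f (suc x)        ≡⟨ cong₂ _+_ (split-qt f q (pred s) (≤-reflexive (suc-pred s))) (cong f s*) ⟩
        N x + M q + f (s * suc q)        ≡⟨ +-assoc (N x) (M q) _ ⟩
        N x + M (suc q)                  ≡⟨ cong (_+ M (suc q)) (trans (sym (+-identityʳ (N x))) (cong (λ z → N x + z * f (suc x)) (sym (ν-multiple (subst (s ∣_) (sym s*) (m∣m*n (suc q))))))) ⟩
        N (suc x) + M (suc q)            ≡⟨ cong (λ z → N z + M (suc q)) last ⟨
        N (suc q * s + 0) + M (suc q)    ∎
        where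
        open ≡-Reasoning
        N M : ℕ → ℕ
        N = ∑ (λ j → ν (suc j) * f (suc j))
        M = ∑ (λ j → f (s * suc j))
        x : ℕ
        x = q * s + pred s
        s* : suc x ≡ s * suc q
        s* = begin
          suc (q * s + pred s)   ≡⟨ +-suc (q * s) (pred s) ⟨
          q * s + suc (pred s)   ≡⟨ cong (q * s +_) (suc-pred s) ⟩
          q * s + s              ≡⟨ re q s ⟩
          s * suc q              ∎
          where
          re : ∀ q s → q * s + s ≡ s * suc q
          re = solve-∀
        last : suc q * s + 0 ≡ suc x
        last = trans (+-identityʳ (suc q * s)) (trans (*-comm (suc q) s) (sym s*))
      split-qt f q (suc t) t<s = begin
        ∑ (f ∘ suc) (q * s + suc t)      ≡⟨ cong (∑ (f ∘ suc)) (+-suc (q * s) t) ⟩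
        ∑ (f ∘ suc) x + f (suc x)        ≡⟨ cong (_+ f (suc x)) (split-qt f q t (<-trans ≤-refl t<s)) ⟩
        N x + M q + f (suc x)            ≡⟨ re (N x) (M q) (f (suc x)) ⟩
        N x + 1 * f (suc x) + M q        ≡⟨ cong (λ z → N x + z * f (suc x) + M q) (ν-other s∤) ⟨
        N (suc x) + M q                  ≡⟨ cong (λ z → N z + M q) (+-suc (q * s) t) ⟨
        N (q * s + suc t) + M q          ∎
        where
        open ≡-Reasoning
        N M : ℕ → ℕ
        N = ∑ (λ j → ν (suc j) * f (suc j))
        M = ∑ (λ j → f (s * suc j))
        x : ℕ
        x = q * s + t
        s∤ : ¬ s ∣ suc x
        s∤ s∣ = >⇒∤ t<s (∣m+n∣m⇒∣n (subst (s ∣_) (sym (+-suc (q * s) t)) s∣) (n∣m*n q))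
        re : ∀ a b c → a + b + c ≡ a + 1 * c + b
        re = solve-∀

    split-multiples : ∀ f n →
      ∑ (f ∘ suc) n ≡ ∑ (λ j → ν (suc j) * f (suc j)) n + ∑ (λ j → f (s * suc j)) (n / s)
    split-multiples f n =
      subst (λ z → ∑ (f ∘ suc) z ≡ ∑ (λ j → ν (suc j) * f (suc j)) z + ∑ (λ j → f (s * suc j)) (n / s))
        (trans (+-comm (n / s * s) (n % s)) (sym (m≡m%n+[m/n]*n n s)))
        (split-qt f (n / s) (n % s) (m%n<n n s))

    private
      pull-factor : ∀ b s x → b * (s * x) ≡ b * x * s
      pull-factor = solve-∀

    -- The first argument is fuel for repeated division by `s`. Fuel `j` suffices for `j` itself,
    -- since i < b s^i.
    decompose : ℕ → ℕ → ℕ × ℕ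
    decompose zero    j = j , 0
    decompose (suc F) j with s ∣? j
    ... | yes (divides q _) = let b , i = decompose F q in b , suc i
    ... | no _              = j , 0

    decompose-chain : ∀ F {b} i → ¬ s ∣ b → i ≤ F → decompose F (b * s ^ i) ≡ (b , i)
    decompose-chain zero {b} zero s∤b _ = cong (_, 0) (*-identityʳ b)
    decompose-chain (suc F) {b} zero s∤b _ with s ∣? (b * 1)
    ... | yes s∣ = contradiction (subst (s ∣_) (*-identityʳ b) s∣) s∤b
    ... | no _   = cong (_, 0) (*-identityʳ b)
    decompose-chain (suc F) {b} (suc i) s∤b (s≤s i≤F) with s ∣? (b * s ^ suc i)
    ... | yes (divides q eq) rewrite *-cancelʳ-≡ q (b * s ^ i) s (trans (sym eq) (pull-factor b s (s ^ i)))
                                   | decompose-chain F i s∤b i≤F = refl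
    ... | no s∤ = contradiction (∣n⇒∣m*n b (m∣m*n (s ^ i))) s∤

    root exponent : ℕ → ℕ
    root j     = proj₁ (decompose j j)
    exponent j = proj₂ (decompose j j)

    decompose-self : ∀ {b} i → 1 ≤ b → ¬ s ∣ b → decompose (b * s ^ i) (b * s ^ i) ≡ (b , i)
    decompose-self {b} i 1≤b s∤b = decompose-chain (b * s ^ i) i s∤b (<⇒≤ (n<b*s^n i 1≤b))

    root-chain : ∀ {b} i → 1 ≤ b → ¬ s ∣ b → root (b * s ^ i) ≡ b
    root-chain i 1≤b s∤b = cong proj₁ (decompose-self i 1≤b s∤b)

    exponent-chain : ∀ {b} i → 1 ≤ b → ¬ s ∣ b → exponent (b * s ^ i) ≡ i
    exponent-chain i 1≤b s∤b = cong proj₂ (decompose-self i 1≤b s∤b)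

    chain-of : ∀ j → 1 ≤ j → ∃[ b ] ∃[ i ] (1 ≤ b × ¬ s ∣ b × j ≡ b * s ^ i)
    chain-of j 1≤j = go j j ≤-refl 1≤j
      where
      go : ∀ F j → j ≤ F → 1 ≤ j → ∃[ b ] ∃[ i ] (1 ≤ b × ¬ s ∣ b × j ≡ b * s ^ i)
      go zero    j j≤F 1≤j = contradiction (≤-trans 1≤j j≤F) 1+n≰n
      go (suc F) j j≤F 1≤j with s ∣? j
      ... | no s∤j = j , 0 , 1≤j , s∤j , sym (*-identityʳ j)
      ... | yes (divides zero refl) = contradiction 1≤j 1+n≰n
      ... | yes (divides q@(suc _) refl) =
        let b , i , 1≤b , s∤b , eq = go F q (≤-pred (≤-trans (m<m*n q s 2≤s) j≤F)) (s≤s z≤n)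
        in b , suc i , 1≤b , s∤b , trans (cong (_* s) eq) (sym (pull-factor b s (s ^ i)))

    exponent-multiple : ∀ j → 1 ≤ j → exponent (s * j) ≡ suc (exponent j)
    exponent-multiple j 1≤j with chain-of j 1≤j
    ... | b , i , 1≤b , s∤b , refl =
      trans (cong exponent (re s b (s ^ i))) (trans (exponent-chain (suc i) 1≤b s∤b) (cong suc (sym (exponent-chain i 1≤b s∤b))))
      where
      re : ∀ s b x → s * (b * x) ≡ b * (s * x)
      re = solve-∀

    exponent-other : ∀ j → 1 ≤ j → ¬ s ∣ j → exponent j ≡ 0
    exponent-other j 1≤j s∤j = trans (cong exponent (sym (*-identityʳ j))) (exponent-chain 0 1≤j s∤j)

    module _ (n : ℕ) where

      -- Powers increase along a chain, so the exponents below `N` that stay within `n` form an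
      -- initial segment. The search from above returns its length.
      cut : ℕ → ℕ → ℕ
      cut b zero    = 0
      cut b (suc N) with b * s ^ N ≤? n
      ... | yes _ = suc N
      ... | no _  = cut b N

      chain-mono : ∀ b {i j} → i ≤ j → b * s ^ i ≤ b * s ^ j
      chain-mono b i≤j = *-monoʳ-≤ b (^-monoʳ-≤ s i≤j)

      cut-≤ : ∀ b N {i} → i < cut b N → b * s ^ i ≤ n
      cut-≤ b (suc N) i<cut with b * s ^ N ≤? n
      ... | yes le = ≤-trans (chain-mono b (≤-pred i<cut)) le
      ... | no _   = cut-≤ b N i<cut

      cut-> : ∀ b N {i} → cut b N ≤ i → n < b * s ^ N → n < b * s ^ i
      cut-> b zero    0≤i n< = <-≤-trans n< (chain-mono b 0≤i)
      cut-> b (suc N) cut≤i n< with b * s ^ N ≤? n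
      ... | yes _ = <-≤-trans n< (chain-mono b cut≤i)
      ... | no nle = cut-> b N cut≤i (≰⇒> nle)

      -- Starting the search at `n` loses nothing for b ≥ 1, because n < b s^n.
      chainLength : ℕ → ℕ
      chainLength b = cut b n

      inside-chain : ∀ {b i} → i < chainLength b → b * s ^ i ≤ n
      inside-chain {b} = cut-≤ b n

      beyond-chain : ∀ {b i} → 1 ≤ b → chainLength b ≤ i → n < b * s ^ i
      beyond-chain {b} 1≤b len≤i = cut-> b n len≤i (n<b*s^n n 1≤b)

      chainLength≤n : ∀ {b} → 1 ≤ b → chainLength b ≤ n
      chainLength≤n {b} 1≤b = ≮⇒≥ λ n<len → <⇒≱ (n<b*s^n n 1≤b) (inside-chain n<len)

      -- Extension by zero beyond `n` lets all chains be summed over one common range of exponents,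
      -- which makes their sums comparable termwise.
      truncate : (ℕ → ℕ) → ℕ → ℕ
      truncate f j with j ≤? n
      ... | yes _ = f j
      ... | no _  = 0

      truncate-≤ : ∀ f {j} → j ≤ n → truncate f j ≡ f j
      truncate-≤ f {j} j≤n with j ≤? n
      ... | yes _  = refl
      ... | no j≰n = contradiction j≤n j≰n

      truncate-> : ∀ f {j} → n < j → truncate f j ≡ 0
      truncate-> f {j} n<j with j ≤? n
      ... | yes j≤n = contradiction j≤n (<⇒≱ n<j)
      ... | no _    = refl

      chainSum : (ℕ → ℕ) → ℕ → ℕ
      chainSum f b = ∑ (λ i → f (b * s ^ i)) (chainLength b)

      -- With C(j) = f(j) + f(sj) + f(s²j) + …, both ∑ f + ∑ C(sj) and ∑_{s∤j} C + ∑ C(sj) equal ∑ C.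
      ∑-by-chains : ∀ f → ∑ (f ∘ suc) n ≡ ∑ (λ j → ν (suc j) * chainSum f (suc j)) n
      ∑-by-chains f = trans (+-cancelʳ-≡ (∑ (λ j → C (s * suc j)) n) _ _ (begin
        ∑ (f ∘ suc) n + ∑ (λ j → C (s * suc j)) n               ≡⟨ ∑-+ (f ∘ suc) (λ j → C (s * suc j)) n ⟨
        ∑ (λ j → f (suc j) + C (s * suc j)) n                   ≡⟨ ∑-cong n (λ {j} j<n → trans (cong (_+ C (s * suc j)) (sym (truncate-≤ f j<n))) (sym (C-step (suc j) (s≤s z≤n)))) ⟩
        ∑ (C ∘ suc) n                                           ≡⟨ split-multiples C n ⟩
        ∑ (λ j → ν (suc j) * C (suc j)) n + ∑ (λ j → C (s * suc j)) (n / s)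
          -- The range can grow from `n / s` to `n`: the added multiples of `s` exceed `n`, where
          -- `C` vanishes. Now the same sum stands on both sides and cancels.
          ≡⟨ cong (∑ (λ j → ν (suc j) * C (suc j)) n +_) (sym (∑-extend n/s≤n (λ {j} le → C-vanish (large le)))) ⟩
        ∑ (λ j → ν (suc j) * C (suc j)) n + ∑ (λ j → C (s * suc j)) n ∎))
        (∑-cong n (λ {j} _ → cong (ν (suc j) *_) (C-chain (suc j) (s≤s z≤n))))
        where
        open ≡-Reasoning
        f̃ : ℕ → ℕ
        f̃ = truncate f
        C : ℕ → ℕ
        C j = ∑ (λ i → f̃ (j * s ^ i)) n
        C-step : ∀ j → 1 ≤ j → C j ≡ f̃ j + C (s * j)
        C-step j 1≤j = begin
          C j                                              ≡⟨ +-identityʳ (C j) ⟨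
          -- The term for i = n is zero as n < j s^n. Adding it makes room to split off the first
          -- term and shift the others.
          C j + 0                                          ≡⟨ cong (C j +_) (truncate-> f (n<b*s^n n 1≤j)) ⟨
          ∑ (λ i → f̃ (j * s ^ i)) (suc n)                  ≡⟨ ∑-first (λ i → f̃ (j * s ^ i)) n ⟩
          f̃ (j * 1) + ∑ (λ i → f̃ (j * (s * s ^ i))) n      ≡⟨ cong₂ _+_ (cong f̃ (*-identityʳ j)) (∑-cong n (λ {i} _ → cong f̃ (re j s (s ^ i)))) ⟩
          f̃ j + C (s * j)                                  ∎
          where
          re : ∀ j s x → j * (s * x) ≡ s * j * x
          re = solve-∀
        C-vanish : ∀ {j} → n < j → C j ≡ 0
        C-vanish {j} n<j = ∑-zero n (λ {i} _ → truncate-> f (<-≤-trans n<j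
          (≤-trans (≤-reflexive (sym (*-identityʳ j))) (*-monoʳ-≤ j (^-monoʳ-≤ s {0} {i} z≤n)))))
        C-chain : ∀ j → 1 ≤ j → C j ≡ chainSum f j
        C-chain j 1≤j = trans
          (∑-extend (chainLength≤n 1≤j) (λ len≤i → truncate-> f (beyond-chain 1≤j len≤i)))
          (∑-cong (chainLength j) (λ i<len → truncate-≤ f (inside-chain i<len)))
        n/s≤n : n / s ≤ n
        n/s≤n = ≤-trans (m≤m*n (n / s) s) (≤-trans (m≤n+m _ (n % s)) (≤-reflexive (sym (m≡m%n+[m/n]*n n s))))
        large : ∀ {j} → n / s ≤ j → n < s * suc j
        large {j} le = <-≤-trans
          (subst (_< suc (n / s) * s) (sym (m≡m%n+[m/n]*n n s)) (+-monoˡ-< (n / s * s) (m%n<n n s)))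
          (≤-trans (*-monoˡ-≤ s (s≤s le)) (≤-reflexive (*-comm (suc j) s)))

      ∑-mono-chains : ∀ f h → (∀ {b} → 1 ≤ b → ¬ s ∣ b → chainSum f b ≤ chainSum h b) →
                      ∑ (f ∘ suc) n ≤ ∑ (h ∘ suc) n
      ∑-mono-chains f h le = subst₂ _≤_ (sym (∑-by-chains f)) (sym (∑-by-chains h)) (∑-mono n (λ {j} _ → weighted (suc j) (s≤s z≤n)))
        where
        weighted : ∀ b → 1 ≤ b → ν b * chainSum f b ≤ ν b * chainSum h b
        weighted b 1≤b with s ∣? b
        ... | yes _  = z≤n
        ... | no s∤b = +-monoˡ-≤ 0 (le 1≤b s∤b)

    module GPFreeSize (k : ℕ) (R : ℕ → ℕ) (largest : ∀ ℓ → LargestAPFree k ℓ (R ℓ)) where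
      open APFreeSize k R largest

      digit : ℕ → ℕ
      digit i = R (suc i) ∸ R i

      R-suc : ∀ n → R (suc n) ≡ R n + digit n
      R-suc n = sym (m+[n∸m]≡n (R-step n))

      digit≤1 : ∀ i → digit i ≤ 1
      digit≤1 i = m≤n+o⇒m∸n≤o (R (suc i)) (R i) (≤-trans (R-step≤1 i) (≤-reflexive (+-comm 1 (R i))))

      ∑-digit : ∀ n → ∑ digit n ≡ R n
      ∑-digit zero    = sym R-0
      ∑-digit (suc n) = trans (cong (_+ digit n) (∑-digit n)) (sym (R-suc n))

      chainSum-digit : ∀ n {b} → 1 ≤ b → ¬ s ∣ b → chainSum n (digit ∘ exponent) b ≡ R (chainLength n b)
      chainSum-digit n {b} 1≤b s∤b =
        trans (∑-cong (chainLength n b) (λ {i} _ → cong digit (exponent-chain i 1≤b s∤b))) (∑-digit (chainLength n b))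

      private
        power : ∀ b i d j → b * s ^ i * (s ^ d) ^ j ≡ b * s ^ (i + d * j)
        power b i d j = begin
          b * s ^ i * (s ^ d) ^ j       ≡⟨ *-assoc b (s ^ i) _ ⟩
          b * (s ^ i * (s ^ d) ^ j)     ≡⟨ cong (λ z → b * (s ^ i * z)) (^-*-assoc s d j) ⟩
          b * (s ^ i * s ^ (d * j))     ≡⟨ cong (b *_) (^-distribˡ-+-* s i (d * j)) ⟨
          b * s ^ (i + d * j)           ∎
          where open ≡-Reasoning

      GPFree-size≤ : ∀ n p → ¬ ContainsGP k s n p → size (p ∘ suc) n ≤ ∑ (digit ∘ exponent ∘ suc) n
      GPFree-size≤ n p free = ∑-mono-chains n (𝟙 ∘ p) (digit ∘ exponent) chain≤
        where
        chain≤ : ∀ {b} → 1 ≤ b → ¬ s ∣ b → chainSum n (𝟙 ∘ p) b ≤ chainSum n (digit ∘ exponent) b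
        chain≤ {b} 1≤b s∤b = ≤-trans
          (upper {chainLength n b} {λ i → p (b * s ^ i)} λ { (v , d , 1≤d , h) →
            free (b * s ^ v , d , ≤-trans (s≤s z≤n) (n<b*s^n v 1≤b) , 1≤d , λ {j} j<k →
              ≤-trans (≤-reflexive (power b v d j)) (inside-chain n (proj₁ (h j<k))) ,
              trans (cong p (power b v d j)) (proj₂ (h j<k))) })
          (≤-reflexive (sym (chainSum-digit n 1≤b s∤b)))

      best : ℕ → ℕ → Bool
      best ℓ = proj₁ (proj₂ (largest ℓ))

      -- A progression whose ratio is a power of `s` never leaves the chain of its first term. Hence
      -- largest progression-free sets of exponents can be chosen on each chain independently and
      -- glued.
      optimal : ℕ → ℕ → Bool
      optimal n j = best (chainLength n (root j)) (exponent j)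

      optimal-chain : ∀ n {b} i → 1 ≤ b → ¬ s ∣ b → optimal n (b * s ^ i) ≡ best (chainLength n b) i
      optimal-chain n i 1≤b s∤b =
        cong₂ (λ b i → best (chainLength n b) i) (root-chain i 1≤b s∤b) (exponent-chain i 1≤b s∤b)

      optimal-free : ∀ n → ¬ ContainsGP k s n (optimal n)
      optimal-free n (a , d , 1≤a , 1≤d , h) with chain-of a 1≤a
      ... | b , i , 1≤b , s∤b , refl =
        proj₁ (proj₂ (proj₂ (largest (chainLength n b)))) (i , d , 1≤d , λ {j} j<k →
          let le , eq = h j<k
          in ≰⇒> (λ len≤ → <⇒≱ (beyond-chain n 1≤b len≤) (≤-trans (≤-reflexive (sym (power b i d j))) le)) ,
             trans (sym (optimal-chain n (i + d * j) 1≤b s∤b)) (trans (cong (optimal n) (sym (power b i d j))) eq))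

      ≤optimal-size : ∀ n → ∑ (digit ∘ exponent ∘ suc) n ≤ size (optimal n ∘ suc) n
      ≤optimal-size n = ∑-mono-chains n (digit ∘ exponent) (𝟙 ∘ optimal n) chain≤
        where
        chain≤ : ∀ {b} → 1 ≤ b → ¬ s ∣ b → chainSum n (digit ∘ exponent) b ≤ chainSum n (𝟙 ∘ optimal n) b
        chain≤ {b} 1≤b s∤b = ≤-reflexive (begin
          chainSum n (digit ∘ exponent) b                         ≡⟨ chainSum-digit n 1≤b s∤b ⟩
          R (chainLength n b)                                     ≡⟨ proj₂ (proj₂ (proj₂ (largest (chainLength n b)))) ⟨
          size (best (chainLength n b)) (chainLength n b)         ≡⟨ ∑-cong (chainLength n b) (λ {i} _ → cong 𝟙 (sym (optimal-chain n i 1≤b s∤b))) ⟩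
          chainSum n (𝟙 ∘ optimal n) b                            ∎)
          where open ≡-Reasoning

      largest-GPFree : ∀ n → LargestGPFree k s n (∑ (digit ∘ exponent ∘ suc) n)
      largest-GPFree n = GPFree-size≤ n , optimal n , optimal-free n ,
        ≤-antisym (GPFree-size≤ n (optimal n) (optimal-free n)) (≤optimal-size n)

open GeometricChains

-- Base-s expansions: digit averages, and periodicity of rational expansions

module BaseExpansions where
  open Nat using (_*_; _/_; _%_)

  -- With `σ` as the parameter, the factor s - 1 of the theorem involves no subtraction.
  module Digits (σ : ℕ) (1≤σ : 1 ≤ σ) where
    s : ℕ
    s = suc σ

    open Chain s (s≤s 1≤σ)

    -- The integer with base-s digits δ 0, …, δ (n ∸ 1), most significant first.
    value : (ℕ → ℕ) → ℕ → ℕ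
    value δ zero    = 0
    value δ (suc n) = s * value δ n + δ n

    -- `value` grows at the last digit, whereas `total-recursion` consumes the first; the inductions
    -- on `K` below need both views.
    value-first : ∀ δ n → value δ (suc n) ≡ δ 0 * s ^ n + value (δ ∘ suc) n
    value-first δ zero    = re σ (δ 0)
      where
      re : ∀ σ d → suc σ * 0 + d ≡ d * 1 + 0
      re = solve-∀
    value-first δ (suc n) = trans (cong (λ z → s * z + δ (suc n)) (value-first δ n)) (re σ (δ 0) (s ^ n) (value (δ ∘ suc) n) (δ (suc n)))
      where
      re : ∀ σ d x v e → suc σ * (d * x + v) + e ≡ d * (suc σ * x) + (suc σ * v + e)
      re = solve-∀

    value-lower : ∀ δ n e → value δ n * s ^ e ≤ value δ (n + e)
    value-lower δ n zero    = ≤-reflexive (trans (*-identityʳ _) (cong (value δ) (sym (+-identityʳ n))))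
    value-lower δ n (suc e) = begin
      value δ n * (s * s ^ e)     ≡⟨ re (value δ n) σ (s ^ e) ⟩
      s * (value δ n * s ^ e)     ≤⟨ *-monoʳ-≤ s (value-lower δ n e) ⟩
      s * value δ (n + e)         ≤⟨ m≤m+n _ (δ (n + e)) ⟩
      value δ (suc (n + e))       ≡⟨ cong (value δ) (+-suc n e) ⟨
      value δ (n + suc e)         ∎
      where
      open ≤-Reasoning
      re : ∀ v σ x → v * (suc σ * x) ≡ suc σ * (v * x)
      re = solve-∀

    module _ (δ : ℕ → ℕ) (δ≤1 : ∀ i → δ i ≤ 1) where

      -- A tail consisting of ones is worth 1/s + 1/s² + ... = 1/σ. This is the role of the summand
      -- 1: appending a digit 1 multiplies σ v + 1 by exactly `s`, so the induction closes.
      value-upper : ∀ n e → σ * value δ (n + e) + 1 ≤ (σ * value δ n + 1) * s ^ e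
      value-upper n zero    = ≤-reflexive (trans (cong (λ z → σ * value δ z + 1) (+-identityʳ n)) (sym (*-identityʳ _)))
      value-upper n (suc e) = begin
        σ * value δ (n + suc e) + 1              ≡⟨ cong (λ z → σ * value δ z + 1) (+-suc n e) ⟩
        σ * (s * value δ (n + e) + δ (n + e)) + 1
          ≤⟨ +-monoˡ-≤ 1 (*-monoʳ-≤ σ (+-monoʳ-≤ (s * value δ (n + e)) (δ≤1 (n + e)))) ⟩
        σ * (s * value δ (n + e) + 1) + 1        ≡⟨ re₁ σ (value δ (n + e)) ⟩
        s * (σ * value δ (n + e) + 1)            ≤⟨ *-monoʳ-≤ s (value-upper n e) ⟩
        s * ((σ * value δ n + 1) * s ^ e)        ≡⟨ re₂ σ (σ * value δ n + 1) (s ^ e) ⟩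
        (σ * value δ n + 1) * s ^ suc e          ∎
        where
        open ≤-Reasoning
        re₁ : ∀ σ v → σ * (suc σ * v + 1) + 1 ≡ suc σ * (σ * v + 1)
        re₁ = solve-∀
        re₂ : ∀ σ y x → suc σ * (y * x) ≡ y * (suc σ * x)
        re₂ = solve-∀

      value-bound : ∀ n → σ * value δ n ≤ s ^ n
      value-bound n = ≤-trans (m≤m+n _ 1) (≤-trans (value-upper 0 n) (≤-reflexive (re σ (s ^ n))))
        where
        re : ∀ σ x → (σ * 0 + 1) * x ≡ x
        re = solve-∀

    total : (ℕ → ℕ) → ℕ → ℕ
    total δ = ∑ (δ ∘ exponent ∘ suc)

    count-other : ∀ m → ∑ (ν ∘ suc) m ≡ m % s + m / s * σ
    count-other m = +-cancelʳ-≡ (m / s) _ _ (begin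
      ∑ (ν ∘ suc) m + m / s                     ≡⟨ cong₂ _+_ (∑-cong m (λ {j} _ → sym (*-identityʳ (ν (suc j))))) (sym (∑-one (m / s))) ⟩
      ∑ (λ j → ν (suc j) * 1) m + ∑ (λ _ → 1) (m / s)   ≡⟨ split-multiples (λ _ → 1) m ⟨
      ∑ (λ _ → 1) m                             ≡⟨ ∑-one m ⟩
      m                                         ≡⟨ m≡m%n+[m/n]*n m s ⟩
      m % s + m / s * s                         ≡⟨ re (m % s) (m / s) σ ⟩
      m % s + m / s * σ + m / s                 ∎)
      where
      open ≡-Reasoning
      ∑-one : ∀ n → ∑ (λ _ → 1) n ≡ n
      ∑-one zero    = refl
      ∑-one (suc n) = trans (cong (_+ 1) (∑-one n)) (+-comm n 1)
      re : ∀ t q σ → t + q * suc σ ≡ t + q * σ + q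
      re = solve-∀

    -- Non-multiples of `s` have exponent 0 and contribute the first digit each. Dividing the
    -- multiples by `s` lowers the exponent by one, which shifts the digit sequence.
    total-recursion : ∀ δ m → total δ m ≡ δ 0 * (m % s + m / s * σ) + total (δ ∘ suc) (m / s)
    total-recursion δ m = begin
      total δ m
        ≡⟨ split-multiples (δ ∘ exponent) m ⟩
      ∑ (λ j → ν (suc j) * δ (exponent (suc j))) m + ∑ (λ j → δ (exponent (s * suc j))) (m / s)
        ≡⟨ cong₂ _+_ (∑-cong m (λ {j} _ → other j)) (∑-cong (m / s) (λ {j} _ → cong δ (exponent-multiple (suc j) (s≤s z≤n)))) ⟩
      ∑ (λ j → δ 0 * ν (suc j)) m + total (δ ∘ suc) (m / s)
        ≡⟨ cong (_+ total (δ ∘ suc) (m / s)) (trans (∑-*ˡ (δ 0) (ν ∘ suc) m) (cong (δ 0 *_) (count-other m))) ⟩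
      δ 0 * (m % s + m / s * σ) + total (δ ∘ suc) (m / s) ∎
      where
      open ≡-Reasoning
      other : ∀ j → ν (suc j) * δ (exponent (suc j)) ≡ δ 0 * ν (suc j)
      other j = by-cases (s ∣? suc j)
        where
        by-cases : Dec (s ∣ suc j) → ν (suc j) * δ (exponent (suc j)) ≡ δ 0 * ν (suc j)
        by-cases (yes s∣) = trans (cong (_* δ (exponent (suc j))) (ν-multiple s∣))
          (sym (trans (cong (δ 0 *_) (ν-multiple s∣)) (*-zeroʳ (δ 0))))
        by-cases (no s∤)  = trans (cong₂ (λ x i → x * δ i) (ν-other s∤) (exponent-other (suc j) (s≤s z≤n) s∤))
          (trans (*-comm 1 (δ 0)) (cong (δ 0 *_) (sym (ν-other s∤))))

    total≤ : ∀ δ → (∀ i → δ i ≤ 1) → ∀ m → total δ m ≤ m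
    total≤ δ δ≤1 m = ∑-≤-length m (λ {j} _ → δ≤1 (exponent (suc j)))

    -- Divided by m s^K, this bounds the digit average by σ value / s^K with error 1/s^K + K/m. The
    -- first error covers all digits after the first `K`; the second covers the rounding in `K`
    -- divisions by `s`, each of which costs at most 1 in `total`. `total-lower` is the counterpart.
    total-upper : ∀ K δ → (∀ i → δ i ≤ 1) → ∀ m → s ^ K * total δ m ≤ σ * m * value δ K + m + K * s ^ K
    total-upper zero δ δ≤1 m = begin
      1 * total δ m            ≤⟨ *-monoʳ-≤ 1 (total≤ δ δ≤1 m) ⟩
      1 * m                    ≡⟨ re σ m ⟩
      σ * m * 0 + m + 0 * 1    ∎
      where
      open ≤-Reasoning
      re : ∀ σ m → 1 * m ≡ σ * m * 0 + m + 0 * 1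
      re = solve-∀
    total-upper (suc K) δ δ≤1 m = begin
      s ^ suc K * total δ m
        ≡⟨ cong (s ^ suc K *_) (total-recursion δ m) ⟩
      s * S * (e * (t + q * σ) + T)
        ≡⟨ re₁ σ S e t q T ⟩
      s * (S * T) + (s * S * e * q * σ + σ * S * e * t) + e * (t * S)
        ≤⟨ +-mono-≤ (+-monoˡ-≤ (s * S * e * q * σ + σ * S * e * t) (*-monoʳ-≤ s (total-upper K (δ ∘ suc) (δ≤1 ∘ suc) q)))
             (*-mono-≤ (δ≤1 0) (*-monoˡ-≤ S (<⇒≤ (m%n<n m s)))) ⟩
      s * (σ * q * v + q + K * S) + (s * S * e * q * σ + σ * S * e * t) + 1 * (s * S)
        -- This slack restores `m = t + q * s` where the induction hypothesis supplies `q * s`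
        -- alone.
        ≤⟨ m≤m+n _ (σ * t * v + t) ⟩
      s * (σ * q * v + q + K * S) + (s * S * e * q * σ + σ * S * e * t) + 1 * (s * S) + (σ * t * v + t)
        ≡⟨ re₂ σ S e t q v K ⟩
      σ * (t + q * s) * (e * S + v) + (t + q * s) + suc K * (s * S)
        ≡⟨ cong₂ (λ x y → σ * x * y + x + suc K * s ^ suc K) (m≡m%n+[m/n]*n m s) (value-first δ K) ⟨
      σ * m * value δ (suc K) + m + suc K * s ^ suc K ∎
      where
      open ≤-Reasoning
      S e t q T v : ℕ
      S = s ^ K
      e = δ 0
      t = m % s
      q = m / s
      T = total (δ ∘ suc) q
      v = value (δ ∘ suc) K
      re₁ : ∀ σ S e t q T → suc σ * S * (e * (t + q * σ) + T) ≡
            suc σ * (S * T) + (suc σ * S * e * q * σ + σ * S * e * t) + e * (t * S)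
      re₁ = solve-∀
      re₂ : ∀ σ S e t q v K →
            suc σ * (σ * q * v + q + K * S) + (suc σ * S * e * q * σ + σ * S * e * t) + 1 * (suc σ * S) + (σ * t * v + t) ≡
            σ * (t + q * suc σ) * (e * S + v) + (t + q * suc σ) + suc K * (suc σ * S)
      re₂ = solve-∀

    total-lower : ∀ K δ → (∀ i → δ i ≤ 1) → ∀ m → σ * m * value δ K ≤ s ^ K * total δ m + m + K * s ^ K
    total-lower zero δ δ≤1 m = ≤-trans (≤-reflexive (*-zeroʳ (σ * m))) z≤n
    total-lower (suc K) δ δ≤1 m = begin
      σ * m * value δ (suc K)
        ≡⟨ cong₂ (λ x y → σ * x * y) (m≡m%n+[m/n]*n m s) (value-first δ K) ⟩
      σ * (t + q * s) * (e * S + v)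
        ≡⟨ re₁ σ S e t q v ⟩
      σ * t * e * S + σ * q * s * e * S + s * (σ * q * v) + t * (σ * v)
        ≤⟨ +-mono-≤ (+-monoʳ-≤ (σ * t * e * S + σ * q * s * e * S) (*-monoʳ-≤ s (total-lower K (δ ∘ suc) (δ≤1 ∘ suc) q)))
             (*-mono-≤ (<⇒≤ (m%n<n m s)) (value-bound (δ ∘ suc) (δ≤1 ∘ suc) K)) ⟩
      σ * t * e * S + σ * q * s * e * S + s * (S * T + q + K * S) + s * S
        ≤⟨ m≤m+n _ (t * e * S + t) ⟩
      σ * t * e * S + σ * q * s * e * S + s * (S * T + q + K * S) + s * S + (t * e * S + t)
        ≡⟨ re₂ σ S e t q T K ⟩
      s * S * (e * (t + q * σ) + T) + (t + q * s) + suc K * (s * S)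
        ≡⟨ cong₂ (λ x y → s ^ suc K * x + y + suc K * s ^ suc K) (total-recursion δ m) (m≡m%n+[m/n]*n m s) ⟨
      s ^ suc K * total δ m + m + suc K * s ^ suc K ∎
      where
      open ≤-Reasoning
      S e t q T v : ℕ
      S = s ^ K
      e = δ 0
      t = m % s
      q = m / s
      T = total (δ ∘ suc) q
      v = value (δ ∘ suc) K
      re₁ : ∀ σ S e t q v → σ * (t + q * suc σ) * (e * S + v) ≡
            σ * t * e * S + σ * q * suc σ * e * S + suc σ * (σ * q * v) + t * (σ * v)
      re₁ = solve-∀
      re₂ : ∀ σ S e t q T K →
            σ * t * e * S + σ * q * suc σ * e * S + suc σ * (S * T + q + K * S) + suc σ * S + (t * e * S + t) ≡
            suc σ * S * (e * (t + q * σ) + T) + (t + q * suc σ) + suc K * (suc σ * S)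
      re₂ = solve-∀

    -- The two bounds say that P / Q lies between the truncation to `n` digits and that truncation
    -- plus s^(-n). Together they express, inside ℕ, that P / Q has the digits δ.
    module Periodicity (δ : ℕ → ℕ) (δ≤1 : ∀ i → δ i ≤ 1) (P Q : ℕ) (1≤Q : 1 ≤ Q)
      (lower : ∀ n → Q * value δ n ≤ P * s ^ n) (upper : ∀ n → P * s ^ n ≤ Q * value δ n + Q)
      (infinite : ∀ n → ¬ (∀ e → δ (n + e) ≡ 0)) where

      -- Q times the tail ∑_{i ≥ n} δ(i) / s^(i−n+1) of the expansion of P / Q.
      remainder : ℕ → ℕ
      remainder n = P * s ^ n ∸ Q * value δ n

      remainder≤Q : ∀ n → remainder n ≤ Q
      remainder≤Q n = m≤n+o⇒m∸n≤o (P * s ^ n) (Q * value δ n) (upper n)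

      remainder-step : ∀ n → s * remainder n ≡ remainder (suc n) + Q * δ n
      remainder-step n = +-cancelˡ-≡ (s * (Q * value δ n)) _ _ (begin
        s * (Q * value δ n) + s * remainder n           ≡⟨ *-distribˡ-+ s (Q * value δ n) (remainder n) ⟨
        s * (Q * value δ n + remainder n)               ≡⟨ cong (s *_) (m+[n∸m]≡n (lower n)) ⟩
        s * (P * s ^ n)                                 ≡⟨ re₁ σ P (s ^ n) ⟩
        P * s ^ suc n                                   ≡⟨ m+[n∸m]≡n (lower (suc n)) ⟨
        Q * value δ (suc n) + remainder (suc n)         ≡⟨ re₂ σ Q (value δ n) (δ n) (remainder (suc n)) ⟩
        s * (Q * value δ n) + (remainder (suc n) + Q * δ n) ∎)
        where
        open ≡-Reasoning
        re₁ : ∀ σ P x → suc σ * (P * x) ≡ P * (suc σ * x)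
        re₁ = solve-∀
        re₂ : ∀ σ Q v d u → Q * (suc σ * v + d) + u ≡ suc σ * (Q * v) + (u + Q * d)
        re₂ = solve-∀

      -- In the long division a remainder 0 forces the digit 0 and the remainder 0 again, so all
      -- later digits would vanish.
      remainder≢0 : ∀ n → remainder n ≢ 0
      remainder≢0 n eq = infinite n (λ e → proj₂ (next (n + e) (vanish e)))
        where
        next : ∀ m → remainder m ≡ 0 → remainder (suc m) ≡ 0 × δ m ≡ 0
        next m eq = m+n≡0⇒m≡0 (remainder (suc m)) sum≡0 , δ≡0 (m*n≡0⇒m≡0∨n≡0 Q (m+n≡0⇒n≡0 (remainder (suc m)) sum≡0))
          where
          sum≡0 : remainder (suc m) + Q * δ m ≡ 0
          sum≡0 = trans (sym (remainder-step m)) (trans (cong (s *_) eq) (*-zeroʳ s))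
          δ≡0 : Q ≡ 0 ⊎ δ m ≡ 0 → δ m ≡ 0
          δ≡0 (inj₁ Q≡0) = contradiction Q≡0 (>⇒≢ 1≤Q)
          δ≡0 (inj₂ eq)  = eq
        vanish : ∀ e → remainder (n + e) ≡ 0
        vanish zero    = trans (cong remainder (+-identityʳ n)) eq
        vanish (suc e) = trans (cong remainder (+-suc n e)) (proj₁ (next (n + e) (vanish e)))

      -- Remainders lie in the half-open range from 0, excluded, to `Q`, included. Two values u + Q
      -- x and v + Q y with u and v in this range agree only if x = y, so a remainder determines the
      -- next digit and the next remainder.
      same-digit : ∀ m n → remainder m ≡ remainder n → δ m ≡ δ n × remainder (suc m) ≡ remainder (suc n)
      same-digit m n eq = digits , +-cancelʳ-≡ (Q * δ n) _ _ (trans (cong (λ d → remainder (suc m) + Q * d) (sym digits)) balance)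
        where
        balance : remainder (suc m) + Q * δ m ≡ remainder (suc n) + Q * δ n
        balance = trans (sym (remainder-step m)) (trans (cong (s *_) eq) (remainder-step n))
        impossible : ∀ {u v} → u ≤ Q → v ≢ 0 → u + Q * 0 ≢ v + Q * 1
        impossible {u} {v} u≤Q v≢0 bal = v≢0 (n≤0⇒n≡0 (+-cancelʳ-≤ Q v 0 (begin
          v + Q       ≡⟨ cong (v +_) (*-identityʳ Q) ⟨
          v + Q * 1   ≡⟨ bal ⟨
          u + Q * 0   ≡⟨ trans (cong (u +_) (*-zeroʳ Q)) (+-identityʳ _) ⟩
          u           ≤⟨ u≤Q ⟩
          Q           ∎)))
          where open ≤-Reasoning
        compare : ∀ {u v x y} → u ≤ Q → v ≤ Q → u ≢ 0 → v ≢ 0 → x ≤ 1 → y ≤ 1 → u + Q * x ≡ v + Q * y → x ≡ y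
        compare u≤ v≤ u≢0 v≢0 z≤n       z≤n       bal = refl
        compare u≤ v≤ u≢0 v≢0 (s≤s z≤n) (s≤s z≤n) bal = refl
        compare u≤ v≤ u≢0 v≢0 z≤n       (s≤s z≤n) bal = contradiction bal (impossible u≤ v≢0)
        compare u≤ v≤ u≢0 v≢0 (s≤s z≤n) z≤n       bal = contradiction (sym bal) (impossible v≤ u≢0)
        digits : δ m ≡ δ n
        digits = compare (remainder≤Q (suc m)) (remainder≤Q (suc n)) (remainder≢0 (suc m)) (remainder≢0 (suc n)) (δ≤1 m) (δ≤1 n) balance

      periodic : ∃[ n ] ∃[ p ] (1 ≤ p × ∀ e → δ (n + e + p) ≡ δ (n + e))
      -- The Q + 2 remainders at positions 0, ..., Q + 1 take at most Q + 1 values. From a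
      -- repetition on, `same-digit` repeats everything.
      periodic with pigeonhole {suc Q} {suc (suc Q)} ≤-refl (λ i → fromℕ< (s≤s (remainder≤Q (toℕ i))))
      ... | i , j , i<j , eq with m≤n⇒∃[o]m+o≡n i<j
      ...   | p , i+p≡j = toℕ i , suc p , s≤s z≤n , λ e → trans (cong δ (shift e)) (sym (proj₁ (same-digit _ _ (same e))))
        where
        same : ∀ e → remainder (toℕ i + e) ≡ remainder (toℕ j + e)
        same zero    = trans (cong remainder (+-identityʳ (toℕ i)))
          (trans (fromℕ<-injective _ _ (s≤s (remainder≤Q (toℕ i))) (s≤s (remainder≤Q (toℕ j))) eq) (cong remainder (sym (+-identityʳ (toℕ j)))))
        same (suc e) = trans (cong remainder (+-suc (toℕ i) e))
          (trans (proj₂ (same-digit _ _ (same e))) (cong remainder (sym (+-suc (toℕ j) e))))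
        shift : ∀ e → toℕ i + e + suc p ≡ toℕ j + e
        shift e = trans (re (toℕ i) e p) (cong (_+ e) i+p≡j)
          where
          re : ∀ i e p → i + e + suc p ≡ suc i + p + e
          re = solve-∀

    module Irrationality (k : ℕ) (3≤k : 3 ≤ k) (R : ℕ → ℕ) (largest : ∀ ℓ → LargestAPFree k ℓ (R ℓ)) where
      open APFreeSize k R largest
      open GPFreeSize k R largest

      digits-infinite : ∀ n → ¬ (∀ e → digit (n + e) ≡ 0)
      digits-infinite n zeros =
        let ℓ , big = R-unbounded 3≤k (suc (R n))
        in <⇒≱ big (≤-trans (R-mono (m≤n+m ℓ n)) (≤-reflexive (constant ℓ)))
        where
        constant : ∀ e → R (n + e) ≡ R n
        constant zero    = cong R (+-identityʳ n)
        constant (suc e) = trans (cong R (+-suc n e))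
          (trans (R-suc (n + e)) (trans (cong₂ _+_ (constant e) (zeros e)) (+-identityʳ _)))

      digits-not-periodic : ∀ n p → 1 ≤ p → ¬ (∀ e → digit (n + e + p) ≡ digit (n + e))
      digits-not-periodic n p 1≤p same = R-not-periodic 3≤k n p c 1≤p λ ℓ n≤ℓ → from-n ℓ (m≤n⇒∃[o]m+o≡n n≤ℓ)
        where
        c : ℕ
        c = R (n + p) ∸ R n
        go : ∀ e → R (n + e + p) ≡ R (n + e) + c
        go zero = trans (cong (λ z → R (z + p)) (+-identityʳ n))
          (trans (sym (m+[n∸m]≡n (R-mono (m≤m+n n p)))) (cong (λ z → R z + c) (sym (+-identityʳ n))))
        go (suc e) = begin
          R (n + suc e + p)                    ≡⟨ cong (λ z → R (z + p)) (+-suc n e) ⟩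
          R (suc (n + e + p))                  ≡⟨ R-suc (n + e + p) ⟩
          R (n + e + p) + digit (n + e + p)    ≡⟨ cong₂ _+_ (go e) (same e) ⟩
          R (n + e) + c + digit (n + e)        ≡⟨ re (R (n + e)) c (digit (n + e)) ⟩
          R (n + e) + digit (n + e) + c        ≡⟨ cong (_+ c) (R-suc (n + e)) ⟨
          R (suc (n + e)) + c                  ≡⟨ cong (λ z → R z + c) (+-suc n e) ⟨
          R (n + suc e) + c                    ∎
          where
          open ≡-Reasoning
          re : ∀ a b c → a + b + c ≡ a + c + b
          re = solve-∀
        from-n : ∀ ℓ → ∃[ e ] n + e ≡ ℓ → R (ℓ + p) ≡ R ℓ + c
        from-n _ (e , refl) = go e

      expansion-irrational : ∀ P Q → 1 ≤ Q → ¬ (∀ n → Q * value digit n ≤ P * s ^ n × P * s ^ n ≤ Q * value digit n + Q)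
      expansion-irrational P Q 1≤Q bounds =
        let n , p , 1≤p , same = Periodicity.periodic digit digit≤1 P Q 1≤Q (proj₁ ∘ bounds) (proj₂ ∘ bounds) digits-infinite
        in digits-not-periodic n p 1≤p same

open BaseExpansions

open import Data.Integer using (+_; -[1+_]; +≤+; +<+)

-- Nonnegative fractions, absolute values and rational limits

module Fractions where
  open Nat using (_*_)

  infix 7.5 _÷_

  opaque
    -- Opaque, so that fractions are compared by cross-multiplication only and never through their
    -- reduced form; `÷≡/` leads back to the library's division.
    _÷_ : ℕ → (b : ℕ) .{{_ : NonZero b}} → ℚ
    a ÷ b = + a ℚ./ b

    ÷≡/ : ∀ a b .{{_ : NonZero b}} → a ÷ b ≡ + a ℚ./ b
    ÷≡/ a b = refl

    toℚᵘ-÷ : ∀ a b → toℚᵘ (a ÷ suc b) ≃ᵘ mkℚᵘ (+ a) b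
    toℚᵘ-÷ a b = ℚ.toℚᵘ-fromℚᵘ (mkℚᵘ (+ a) b)

    ÷-mono-≤ : ∀ a b c d .{{_ : NonZero b}} .{{_ : NonZero d}} → a * d ≤ c * b → a ÷ b ℚ.≤ c ÷ d
    ÷-mono-≤ a (suc b) c (suc d) le = ℚ.toℚᵘ-cancel-≤
      (ℚᵘ.≤-respˡ-≃ (ℚᵘ.≃-sym (toℚᵘ-÷ a b)) (ℚᵘ.≤-respʳ-≃ (ℚᵘ.≃-sym (toℚᵘ-÷ c d))
        (*≤*ᵘ (subst₂ ℤ._≤_ (ℤ.pos-* a (suc d)) (ℤ.pos-* c (suc b)) (+≤+ le)))))

    ÷-cancel-≤ : ∀ a b c d .{{_ : NonZero b}} .{{_ : NonZero d}} → a ÷ b ℚ.≤ c ÷ d → a * d ≤ c * b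
    ÷-cancel-≤ a (suc b) c (suc d) le with
      ℚᵘ.≤-respˡ-≃ (toℚᵘ-÷ a b) (ℚᵘ.≤-respʳ-≃ (toℚᵘ-÷ c d) (ℚ.toℚᵘ-mono-≤ le))
    ... | *≤*ᵘ le′ = ℤ.drop‿+≤+ (subst₂ ℤ._≤_ (sym (ℤ.pos-* a (suc d))) (sym (ℤ.pos-* c (suc b))) le′)

    ÷-+ : ∀ a b c d .{{_ : NonZero b}} .{{_ : NonZero d}} → a ÷ b ℚ.+ c ÷ d ≡ _÷_ (a * d + c * b) (b * d) {{m*n≢0 b d}}
    ÷-+ a (suc b) c (suc d) = ℚ.toℚᵘ-injective (begin-equality
      toℚᵘ (a ÷ suc b ℚ.+ c ÷ suc d)                ≃⟨ ℚ.toℚᵘ-homo-+ (a ÷ suc b) (c ÷ suc d) ⟩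
      toℚᵘ (a ÷ suc b) ℚᵘ.+ toℚᵘ (c ÷ suc d)        ≃⟨ ℚᵘ.+-cong (toℚᵘ-÷ a b) (toℚᵘ-÷ c d) ⟩
      mkℚᵘ (+ a) b ℚᵘ.+ mkℚᵘ (+ c) d                ≡⟨ cong (λ z → mkℚᵘ z _) (trans (cong₂ ℤ._+_ (sym (ℤ.pos-* a (suc d))) (sym (ℤ.pos-* c (suc b)))) (sym (ℤ.pos-+ (a * suc d) (c * suc b)))) ⟩
      mkℚᵘ (+ (a * suc d + c * suc b)) _            ≃⟨ toℚᵘ-÷ (a * suc d + c * suc b) _ ⟨
      toℚᵘ ((a * suc d + c * suc b) ÷ (suc b * suc d)) ∎)
      where open ℚᵘ.≤-Reasoning

    ÷-* : ∀ a b c d .{{_ : NonZero b}} .{{_ : NonZero d}} → a ÷ b ℚ.* c ÷ d ≡ _÷_ (a * c) (b * d) {{m*n≢0 b d}}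
    ÷-* a (suc b) c (suc d) = ℚ.toℚᵘ-injective (begin-equality
      toℚᵘ (a ÷ suc b ℚ.* c ÷ suc d)                ≃⟨ ℚ.toℚᵘ-homo-* (a ÷ suc b) (c ÷ suc d) ⟩
      toℚᵘ (a ÷ suc b) ℚᵘ.* toℚᵘ (c ÷ suc d)        ≃⟨ ℚᵘ.*-cong (toℚᵘ-÷ a b) (toℚᵘ-÷ c d) ⟩
      mkℚᵘ (+ a) b ℚᵘ.* mkℚᵘ (+ c) d                ≡⟨ cong (λ z → mkℚᵘ z _) (sym (ℤ.pos-* a c)) ⟩
      mkℚᵘ (+ (a * c)) _                            ≃⟨ toℚᵘ-÷ (a * c) _ ⟨
      toℚᵘ ((a * c) ÷ (suc b * suc d))              ∎)
      where open ℚᵘ.≤-Reasoning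

    archimedean : ∀ {ε} → 0ℚ ℚ.< ε → ∃[ N ] 1 ÷ suc N ℚ.< ε
    archimedean {mkℚ (+ zero) q c} (*<* (+<+ ()))
    archimedean {mkℚ -[1+ p ] q c} (*<* ())
    -- The denominator of ε is q + 1. Taking 1/(q + 2) keeps the inequality strict even when the
    -- numerator is 1.
    archimedean {ε@(mkℚ (+ suc p) q c)} 0<ε = suc q , ℚ.toℚᵘ-cancel-<
      (ℚᵘ.<-respˡ-≃ (ℚᵘ.≃-sym (toℚᵘ-÷ 1 (suc q)))
        (*<*ᵘ (subst₂ ℤ._<_ (ℤ.pos-* 1 (suc q)) (ℤ.pos-* (suc p) (suc (suc q)))
          (+<+ (≤-trans (s≤s (≤-reflexive (+-identityʳ (suc q)))) (m≤n*m (suc (suc q)) (suc p)))))))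

  0≤÷ : ∀ a b .{{_ : NonZero b}} → 0ℚ ℚ.≤ a ÷ b
  0≤÷ a b = subst (ℚ._≤ a ÷ b) (÷≡/ 0 1) (÷-mono-≤ 0 1 a b z≤n)

  ÷-cong : ∀ a b c d .{{_ : NonZero b}} .{{_ : NonZero d}} → a * d ≡ c * b → a ÷ b ≡ c ÷ d
  ÷-cong a b c d eq = ℚ.≤-antisym (÷-mono-≤ a b c d (≤-reflexive eq)) (÷-mono-≤ c d a b (≤-reflexive (sym eq)))

  ÷-≤-+ : ∀ a b c d e f .{{b≢0 : NonZero b}} .{{_ : NonZero d}} .{{_ : NonZero f}} →
          a * (d * f) ≤ (c * f + e * d) * b → a ÷ b ℚ.≤ c ÷ d ℚ.+ e ÷ f
  ÷-≤-+ a b c d e f {{b≢0}} le = ℚ.≤-trans (÷-mono-≤ a b (c * f + e * d) (d * f) {{b≢0}} {{m*n≢0 d f}} le) (ℚ.≤-reflexive (sym (÷-+ c d e f)))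

  nonNegative-÷ : ∀ q → 0ℚ ℚ.≤ q → ∃[ P ] ∃[ d ] P ÷ suc d ≡ q
  nonNegative-÷ (mkℚ -[1+ _ ] _ _)   (*≤* ())
  nonNegative-÷ q@(mkℚ (+ P) d _) _ = P , d , trans (÷≡/ P (suc d)) (ℚ.fromℚᵘ-toℚᵘ q)

  ∣p-q∣≤ : ∀ {x y δ} → x ℚ.≤ y ℚ.+ δ → y ℚ.≤ x ℚ.+ δ → ℚ.∣ x ℚ.- y ∣ ℚ.≤ δ
  ∣p-q∣≤ {x} {y} {δ} x≤ y≤ = bound (ℚ.∣p∣≡p∨∣p∣≡-p (x ℚ.- y))
    where
    open ℚ.≤-Reasoning
    difference : ∀ {u v} → u ℚ.≤ v ℚ.+ δ → u ℚ.- v ℚ.≤ δ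
    difference {u} {v} le = begin
      u ℚ.- v               ≤⟨ ℚ.+-monoˡ-≤ (ℚ.- v) le ⟩
      v ℚ.+ δ ℚ.- v         ≡⟨ cong (ℚ._- v) (ℚ.+-comm v δ) ⟩
      δ ℚ.+ v ℚ.- v         ≡⟨ //-rightDividesʳ v δ ⟩
      δ                     ∎
    bound : ℚ.∣ x ℚ.- y ∣ ≡ x ℚ.- y ⊎ ℚ.∣ x ℚ.- y ∣ ≡ ℚ.- (x ℚ.- y) → ℚ.∣ x ℚ.- y ∣ ℚ.≤ δ
    bound (inj₁ eq) = ℚ.≤-trans (ℚ.≤-reflexive eq) (difference x≤)
    bound (inj₂ eq) = ℚ.≤-trans (ℚ.≤-reflexive (trans eq (⁻¹-anti-homo-// x y))) (difference y≤)

  p≤∣p∣ : ∀ p → p ℚ.≤ ℚ.∣ p ∣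
  p≤∣p∣ p with ℚ.≤-total 0ℚ p
  ... | inj₁ 0≤p = ℚ.≤-reflexive (sym (ℚ.0≤p⇒∣p∣≡p 0≤p))
  ... | inj₂ p≤0 = ℚ.≤-trans p≤0 (ℚ.0≤∣p∣ p)

  -- For a real x, `x ≃ fromℚ q` unfolds to `Converges (seq x) q`.
  Converges : (ℕ → ℚ) → ℚ → Set
  Converges x q = ∀ ε → 0ℚ ℚ.< ε → ∃[ N ] (∀ n → N ≤ n → ℚ.∣ x n ℚ.- q ∣ ℚ.< ε)

  private
    0<difference : ∀ {p q} → p ℚ.< q → 0ℚ ℚ.< q ℚ.- p
    0<difference {p} {q} p<q = subst (ℚ._< q ℚ.- p) (ℚ.+-inverseʳ p) (ℚ.+-monoˡ-< (ℚ.- p) p<q)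

    cancel-difference : ∀ {u v} w → u ℚ.- w ℚ.< v ℚ.- w → u ℚ.< v
    cancel-difference {u} {v} w lt = subst₂ ℚ._<_ (//-rightDividesˡ w u) (//-rightDividesˡ w v) (ℚ.+-monoˡ-< w lt)

  ∣p-q∣-comm : ∀ p q → ℚ.∣ p ℚ.- q ∣ ≡ ℚ.∣ q ℚ.- p ∣
  ∣p-q∣-comm p q = trans (sym (ℚ.∣-p∣≡∣p∣ (p ℚ.- q))) (cong ℚ.∣_∣ (⁻¹-anti-homo-// p q))

  limit-lower : ∀ {x q c} n → Converges x q → (∀ m → n ≤ m → c ℚ.≤ x m) → c ℚ.≤ q
  limit-lower {x} {q} {c} n conv le = ℚ.≮⇒≥ λ q<c →
    let N , close = conv (c ℚ.- q) (0<difference q<c)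
        m = N ⊔ n
        x<c = cancel-difference q (ℚ.≤-<-trans (p≤∣p∣ (x m ℚ.- q)) (close m (m≤m⊔n N n)))
    in ℚ.<-irrefl refl (ℚ.<-≤-trans x<c (le m (m≤n⊔m N n)))

  limit-upper : ∀ {x q c} n → Converges x q → (∀ m → n ≤ m → x m ℚ.≤ c) → q ℚ.≤ c
  limit-upper {x} {q} {c} n conv le = ℚ.≮⇒≥ λ c<q →
    let N , close = conv (q ℚ.- c) (0<difference c<q)
        m = N ⊔ n
        q-x<q-c = ℚ.≤-<-trans (p≤∣p∣ (q ℚ.- x m)) (subst (ℚ._< q ℚ.- c) (∣p-q∣-comm (x m) q) (close m (m≤m⊔n N n)))
    in ℚ.<-irrefl refl (ℚ.<-≤-trans q-x<q-c (ℚ.+-monoʳ-≤ q (ℚ.neg-antimono-≤ (le m (m≤n⊔m N n)))))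

open Fractions

-- The real number L, and the convergence of the density to it

module Limit where
  open Nat using (_*_)

  module Limits (σ : ℕ) (1≤σ : 1 ≤ σ) (δ : ℕ → ℕ) (δ≤1 : ∀ i → δ i ≤ 1) where
    open Digits σ 1≤σ
    open Chain s (s≤s 1≤σ) using (n<s^n)

    infix 7.5 _÷s^_

    s^≢0 : ∀ n → NonZero (s ^ n)
    s^≢0 n = m^n≢0 s n

    _÷s^_ : ℕ → ℕ → ℚ
    a ÷s^ n = _÷_ a (s ^ n) {{s^≢0 n}}

    digitSum : ℕ → ℚ
    digitSum n = value δ n ÷s^ n

    approx : ℕ → ℚ
    approx n = (σ * value δ n) ÷s^ n

    approx-scale : ∀ n → σ ÷ 1 ℚ.* digitSum n ≡ approx n
    approx-scale n = trans (÷-* σ 1 (value δ n) (s ^ n) {{_}} {{s^≢0 n}})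
      (÷-cong (σ * value δ n) (1 * s ^ n) (σ * value δ n) (s ^ n) {{m*n≢0 1 (s ^ n) {{_}} {{s^≢0 n}}}} {{s^≢0 n}} (cong (σ * value δ n *_) (sym (*-identityˡ (s ^ n)))))

    approx-mono : ∀ {n m} → n ≤ m → approx n ℚ.≤ approx m
    approx-mono {n} n≤m with e , refl ← m≤n⇒∃[o]m+o≡n n≤m =
      ÷-mono-≤ (σ * value δ n) (s ^ n) (σ * value δ (n + e)) (s ^ (n + e)) {{s^≢0 n}} {{s^≢0 (n + e)}} (begin
      σ * value δ n * s ^ (n + e)         ≡⟨ cong (σ * value δ n *_) (^-distribˡ-+-* s n e) ⟩
      σ * value δ n * (s ^ n * s ^ e)     ≡⟨ re σ (value δ n) (s ^ n) (s ^ e) ⟩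
      σ * (value δ n * s ^ e) * s ^ n     ≤⟨ *-monoˡ-≤ (s ^ n) (*-monoʳ-≤ σ (value-lower δ n e)) ⟩
      σ * value δ (n + e) * s ^ n         ∎)
      where
      open ≤-Reasoning
      re : ∀ σ v x y → σ * v * (x * y) ≡ σ * (v * y) * x
      re = solve-∀

    approx-upper : ∀ {n m} → n ≤ m → approx m ℚ.≤ (σ * value δ n + 1) ÷s^ n
    approx-upper {n} n≤m with e , refl ← m≤n⇒∃[o]m+o≡n n≤m =
      ÷-mono-≤ (σ * value δ (n + e)) (s ^ (n + e)) (σ * value δ n + 1) (s ^ n) {{s^≢0 (n + e)}} {{s^≢0 n}} (begin
      σ * value δ (n + e) * s ^ n                 ≤⟨ *-monoˡ-≤ (s ^ n) (≤-trans (m≤m+n _ 1) (value-upper δ δ≤1 n e)) ⟩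
      (σ * value δ n + 1) * s ^ e * s ^ n         ≡⟨ re (σ * value δ n + 1) (s ^ e) (s ^ n) ⟩
      (σ * value δ n + 1) * (s ^ n * s ^ e)       ≡⟨ cong ((σ * value δ n + 1) *_) (^-distribˡ-+-* s n e) ⟨
      (σ * value δ n + 1) * s ^ (n + e)           ∎)
      where
      open ≤-Reasoning
      re : ∀ v x y → v * x * y ≡ v * (y * x)
      re = solve-∀

    approx-close : ∀ {n m} N .{{_ : NonZero N}} → n ≤ m → N ≤ s ^ n → approx m ℚ.≤ approx n ℚ.+ 1 ÷ N
    approx-close {n} N n≤m N≤s^n = ℚ.≤-trans (approx-upper n≤m)
      (÷-≤-+ (σ * value δ n + 1) (s ^ n) (σ * value δ n) (s ^ n) 1 N {{s^≢0 n}} {{s^≢0 n}} (begin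
        (σ * value δ n + 1) * (s ^ n * N)            ≡⟨ re₁ (σ * value δ n) (s ^ n) N ⟩
        σ * value δ n * N * s ^ n + N * s ^ n        ≤⟨ +-monoʳ-≤ (σ * value δ n * N * s ^ n) (*-monoˡ-≤ (s ^ n) N≤s^n) ⟩
        σ * value δ n * N * s ^ n + s ^ n * s ^ n    ≡⟨ re₂ (σ * value δ n) (s ^ n) N ⟩
        (σ * value δ n * N + 1 * s ^ n) * s ^ n      ∎))
      where
      open ≤-Reasoning
      re₁ : ∀ v x N → (v + 1) * (x * N) ≡ v * N * x + N * x
      re₁ = solve-∀
      re₂ : ∀ v x N → v * N * x + x * x ≡ (v * N + 1 * x) * x
      re₂ = solve-∀

    approx-within : ∀ {n m} N → N ≤ n → n ≤ m → ℚ.∣ approx n ℚ.- approx m ∣ ℚ.≤ 1 ÷ suc N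
    approx-within {n} {m} N N≤n n≤m = ∣p-q∣≤
      (ℚ.≤-trans (approx-mono n≤m) (subst (ℚ._≤ approx m ℚ.+ 1 ÷ suc N) (ℚ.+-identityʳ (approx m))
        (ℚ.+-monoʳ-≤ (approx m) (0≤÷ 1 (suc N)))))
      (approx-close (suc N) n≤m (≤-trans (s≤s N≤n) (n<s^n n)))

    L : ℝ
    L .seq = approx
    L .cauchy ε 0<ε with archimedean 0<ε
    ... | N , small = N , λ m n N≤m N≤n → ℚ.≤-<-trans (both m n N≤m N≤n (≤-total m n)) small
      where
      both : ∀ m n → N ≤ m → N ≤ n → m ≤ n ⊎ n ≤ m → ℚ.∣ approx m ℚ.- approx n ∣ ℚ.≤ 1 ÷ suc N
      both m n N≤m N≤n (inj₁ m≤n) = approx-within N N≤m m≤n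
      both m n N≤m N≤n (inj₂ n≤m) = ℚ.≤-trans (ℚ.≤-reflexive (∣p-q∣-comm (approx m) (approx n))) (approx-within N N≤n n≤m)

    -- The series is indexed by values of r, the approximations by digit positions. The partial sums
    -- run through approximations with indices at least as large, and so inherit their rate of
    -- convergence.
    cofinal⟶L : ∀ {x} → (∀ M → ∃[ n ] (M ≤ n × x M ≡ approx n)) → x ⟶ L
    cofinal⟶L {x} cofinal ε 0<ε with archimedean 0<ε
    ... | N , small = N , λ M N≤M → let n , M≤n , eq = cofinal M in
      n , λ m n≤m → ℚ.≤-<-trans
        (subst (λ z → ℚ.∣ z ℚ.- approx m ∣ ℚ.≤ 1 ÷ suc N) (sym eq) (approx-within N (≤-trans N≤M M≤n) n≤m)) small

    module _ (M : ℕ) .{{_ : NonZero M}} (n : ℕ) .{{_ : NonZero n}} (M*M≤n : M * M ≤ n) where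
      private
        S V T : ℕ
        S = s ^ M
        V = value δ M
        T = total δ n

        -- Of the two errors 1/s^M and M/n from `total-upper` and `total-lower`, the first is at
        -- most 1/M since M < s^M, the second since M² ≤ n.
        error : M * (n + M * S) ≤ 2 * S * n
        error = begin
          M * (n + M * S)         ≡⟨ re₁ M n S ⟩
          M * n + M * M * S       ≤⟨ +-mono-≤ (*-monoˡ-≤ n (<⇒≤ (n<s^n M))) (*-monoˡ-≤ S M*M≤n) ⟩
          S * n + n * S           ≡⟨ re₂ S n ⟩
          2 * S * n               ∎
          where
          open ≤-Reasoning
          re₁ : ∀ M n S → M * (n + M * S) ≡ M * n + M * M * S
          re₁ = solve-∀
          re₂ : ∀ S n → S * n + n * S ≡ 2 * S * n
          re₂ = solve-∀

      density-upper : T ÷ n ℚ.≤ approx M ℚ.+ 2 ÷ M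
      density-upper = ÷-≤-+ T n (σ * V) S 2 M {{_}} {{s^≢0 M}} (begin
        T * (S * M)                                   ≡⟨ re₁ T S M ⟩
        M * (S * T)                                   ≤⟨ *-monoʳ-≤ M (total-upper M δ δ≤1 n) ⟩
        M * (σ * n * V + n + M * S)                   ≡⟨ re₂ M σ n V S ⟩
        σ * V * M * n + M * (n + M * S)               ≤⟨ +-monoʳ-≤ (σ * V * M * n) error ⟩
        σ * V * M * n + 2 * S * n                     ≡⟨ *-distribʳ-+ n (σ * V * M) (2 * S) ⟨
        (σ * V * M + 2 * S) * n                       ∎)
        where
        open ≤-Reasoning
        re₁ : ∀ T S M → T * (S * M) ≡ M * (S * T)
        re₁ = solve-∀
        re₂ : ∀ M σ n V S → M * (σ * n * V + n + M * S) ≡ σ * V * M * n + M * (n + M * S)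
        re₂ = solve-∀

      density-lower : approx M ℚ.≤ T ÷ n ℚ.+ 2 ÷ M
      density-lower = ÷-≤-+ (σ * V) S T n 2 M {{s^≢0 M}} (begin
        σ * V * (n * M)                               ≡⟨ re₁ σ V n M ⟩
        M * (σ * n * V)                               ≤⟨ *-monoʳ-≤ M (total-lower M δ δ≤1 n) ⟩
        M * (S * T + n + M * S)                       ≡⟨ re₂ M n T S ⟩
        T * M * S + M * (n + M * S)                   ≤⟨ +-monoʳ-≤ (T * M * S) error ⟩
        T * M * S + 2 * S * n                         ≡⟨ re₃ T M S n ⟩
        (T * M + 2 * n) * S                           ∎)
        where
        open ≤-Reasoning
        re₁ : ∀ σ V n M → σ * V * (n * M) ≡ M * (σ * n * V)
        re₁ = solve-∀
        re₂ : ∀ M n T S → M * (S * T + n + M * S) ≡ T * M * S + M * (n + M * S)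
        re₂ = solve-∀
        re₃ : ∀ T M S n → T * M * S + 2 * S * n ≡ (T * M + 2 * n) * S
        re₃ = solve-∀

    density⟶L : (λ n → total δ (suc n) ÷ suc n) ⟶ L
    density⟶L ε 0<ε with archimedean 0<ε
    ... | N , small = M * M , λ n large → M , λ m M≤m → ℚ.≤-<-trans (∣p-q∣≤ (above n large m M≤m) (below n large m M≤m)) small
      where
      M : ℕ
      -- Two of the three parts pay for the density estimate with `M` digits, the third for passing
      -- from `approx M` to `approx m`.
      M = 3 * suc N
      sum : 2 ÷ M ℚ.+ 1 ÷ M ≡ 1 ÷ suc N
      sum = trans (÷-+ 2 M 1 M) (÷-cong (2 * M + 1 * M) (M * M) 1 (suc N) (re N))
        where
        re : ∀ N → (2 * (3 * suc N) + 1 * (3 * suc N)) * suc N ≡ 1 * (3 * suc N * (3 * suc N))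
        re = solve-∀
      open ℚ.≤-Reasoning
      above : ∀ n → M * M ≤ n → ∀ m → M ≤ m → total δ (suc n) ÷ suc n ℚ.≤ approx m ℚ.+ 1 ÷ suc N
      above n large m M≤m = begin
        total δ (suc n) ÷ suc n          ≤⟨ density-upper M (suc n) (m≤n⇒m≤1+n large) ⟩
        approx M ℚ.+ 2 ÷ M               ≤⟨ ℚ.+-mono-≤ (approx-mono M≤m) (÷-mono-≤ 2 M 1 (suc N) 2N≤) ⟩
        approx m ℚ.+ 1 ÷ suc N           ∎
        where
        2N≤ : 2 * suc N ≤ 1 * M
        2N≤ = ≤-trans (*-monoˡ-≤ (suc N) {2} {3} (s≤s (s≤s z≤n))) (≤-reflexive (sym (*-identityˡ M)))
      below : ∀ n → M * M ≤ n → ∀ m → M ≤ m → approx m ℚ.≤ total δ (suc n) ÷ suc n ℚ.+ 1 ÷ suc N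
      below n large m M≤m = begin
        approx m                                           ≤⟨ approx-close M M≤m (<⇒≤ (n<s^n M)) ⟩
        approx M ℚ.+ 1 ÷ M                                 ≤⟨ ℚ.+-monoˡ-≤ (1 ÷ M) (density-lower M (suc n) (m≤n⇒m≤1+n large)) ⟩
        total δ (suc n) ÷ suc n ℚ.+ 2 ÷ M ℚ.+ 1 ÷ M        ≡⟨ ℚ.+-assoc (total δ (suc n) ÷ suc n) (2 ÷ M) (1 ÷ M) ⟩
        total δ (suc n) ÷ suc n ℚ.+ (2 ÷ M ℚ.+ 1 ÷ M)      ≡⟨ cong (total δ (suc n) ÷ suc n ℚ.+_) sum ⟩
        total δ (suc n) ÷ suc n ℚ.+ 1 ÷ suc N              ∎

    -- `L` is σ times the number with digits δ. If L = P / (d + 1), that number is P / (σ (d + 1)),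
    -- whence the choice of `Q`. Monotone approximations turn the limit into inequalities for every
    -- `n`.
    L-rational : ∀ q → L ≃ fromℚ q →
      ∃[ P ] ∃[ Q ] (1 ≤ Q × ∀ n → Q * value δ n ≤ P * s ^ n × P * s ^ n ≤ Q * value δ n + Q)
    L-rational q conv = fraction (nonNegative-÷ q (ℚ.≤-trans (0≤÷ (σ * 0) 1) (limit-lower {approx} {q} {approx 0} 0 conv (λ m _ → approx-mono {0} {m} z≤n))))
      where
      open ≤-Reasoning
      re : ∀ σ d v → σ * d * v ≡ σ * v * d
      re = solve-∀
      lower : ∀ P d → P ÷ suc d ≡ q → ∀ n → σ * suc d * value δ n ≤ P * s ^ n
      lower P d q≡ n = ≤-trans (≤-reflexive (re σ (suc d) (value δ n))) (÷-cancel-≤ (σ * value δ n) (s ^ n) P (suc d) {{s^≢0 n}}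
        (ℚ.≤-trans (limit-lower {approx} {q} {approx n} n conv (λ m → approx-mono {n} {m})) (ℚ.≤-reflexive (sym q≡))))
      upper : ∀ P d → P ÷ suc d ≡ q → ∀ n → P * s ^ n ≤ σ * suc d * value δ n + σ * suc d
      upper P d q≡ n = begin
        P * s ^ n
          ≤⟨ ÷-cancel-≤ P (suc d) (σ * value δ n + 1) (s ^ n) {{_}} {{s^≢0 n}}
               (ℚ.≤-trans (ℚ.≤-reflexive q≡) (limit-upper {approx} {q} n conv (λ m → approx-upper {n} {m}))) ⟩
        (σ * value δ n + 1) * suc d            ≡⟨ *-distribʳ-+ (suc d) (σ * value δ n) 1 ⟩
        σ * value δ n * suc d + 1 * suc d      ≤⟨ +-mono-≤ (≤-reflexive (sym (re σ (suc d) (value δ n)))) (*-monoˡ-≤ (suc d) 1≤σ) ⟩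
        σ * suc d * value δ n + σ * suc d      ∎
      fraction : ∃[ P ] ∃[ d ] P ÷ suc d ≡ q →
        ∃[ P ] ∃[ Q ] (1 ≤ Q × ∀ n → Q * value δ n ≤ P * s ^ n × P * s ^ n ≤ Q * value δ n + Q)
      fraction (P , d , q≡) = P , σ * suc d , *-mono-≤ 1≤σ (s≤s z≤n) , λ n → lower P d q≡ n , upper P d q≡ n

    recip-power : ∀ n → (1 ÷ s) ^ℚ n ≡ 1 ÷s^ n
    recip-power zero    = sym (÷≡/ 1 1)
    recip-power (suc n) = trans (cong (1 ÷ s ℚ.*_) (recip-power n)) (÷-* 1 s 1 (s ^ n) {{_}} {{s^≢0 n}})

    digitSum-zero : ∀ n → δ n ≡ 0 → digitSum (suc n) ≡ digitSum n
    digitSum-zero n eq = ÷-cong (value δ (suc n)) (s ^ suc n) (value δ n) (s ^ n) {{s^≢0 (suc n)}} {{s^≢0 n}}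
      (trans (cong (λ d → (s * value δ n + d) * s ^ n) eq) (re σ (value δ n) (s ^ n)))
      where
      re : ∀ σ v x → (suc σ * v + 0) * x ≡ v * (suc σ * x)
      re = solve-∀

    digitSum-one : ∀ n → δ n ≡ 1 → digitSum (suc n) ≡ digitSum n ℚ.+ (1 ÷ s) ^ℚ suc n
    digitSum-one n eq = trans
      (÷-cong (value δ (suc n)) (s ^ suc n) (value δ n * s ^ suc n + 1 * s ^ n) (s ^ n * s ^ suc n) {{s^≢0 (suc n)}}
        {{m*n≢0 (s ^ n) (s ^ suc n) {{s^≢0 n}} {{s^≢0 (suc n)}}}}
        (trans (cong (λ d → (s * value δ n + d) * (s ^ n * s ^ suc n)) eq) (re σ (value δ n) (s ^ n))))
      (trans (sym (÷-+ (value δ n) (s ^ n) 1 (s ^ suc n) {{s^≢0 n}} {{s^≢0 (suc n)}})) (cong (digitSum n ℚ.+_) (sym (recip-power (suc n)))))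
      where
      re : ∀ σ v x → (suc σ * v + 1) * (x * (suc σ * x)) ≡ (v * (suc σ * x) + 1 * x) * (suc σ * x)
      re = solve-∀

open Limit

open import Data.Rational using (_/_; _*_)

⟶-cong : ∀ {x y : ℕ → ℚ} {z} → (∀ n → x n ≡ y n) → y ⟶ z → x ⟶ z
⟶-cong {z = z} eq lim ε 0<ε = let N , close = lim ε 0<ε in
  N , λ n N≤n → subst (λ q → Within ε q z) (sym (eq n)) (close n N≤n)

-- The series over the values of r

module Series (k : ℕ) (2≤k : 2 ≤ k) (σ : ℕ) (1≤σ : 1 ≤ σ)
              (R : ℕ → ℕ) (largest : ∀ ℓ → LargestAPFree k ℓ (R ℓ)) where
  open Digits σ 1≤σ
  open Chain s (s≤s 1≤σ)
  open GPFreeSize k R largest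
  open APFreeSize k R largest
  open Limits σ 1≤σ digit digit≤1

  FirstHit : ℕ → ℕ → Set
  FirstHit m = IsMin (λ ℓ → 1 ≤ ℓ × R ℓ ≡ m)

  -- A discrete intermediate value argument: `R` starts at 0 and rises by at most one per step, so
  -- it skips no value up to `R ℓ`.
  first-hit : ∀ {m} → 1 ≤ m → ∀ ℓ → m ≤ R ℓ → ∃[ ℓ₀ ] FirstHit m ℓ₀
  first-hit 1≤m zero    m≤R = contradiction (≤-trans 1≤m (≤-trans m≤R (≤-reflexive R-0))) 1+n≰n
  first-hit {m} 1≤m (suc ℓ) m≤R with m ≤? R ℓ
  ... | yes m≤Rℓ = first-hit 1≤m ℓ m≤Rℓ
  ... | no m≰Rℓ  = suc ℓ , (s≤s z≤n , ≤-antisym (≤-trans (R-step≤1 ℓ) (≰⇒> m≰Rℓ)) m≤R) ,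
    λ { ℓ′ (_ , refl) → ≰⇒> (m≰Rℓ ∘ R-mono) }

  jump-first-hit : ∀ {n ℓ} → R (suc n) ≡ suc (R n) → FirstHit (suc (R n)) ℓ → ℓ ≡ suc n
  jump-first-hit {n} {ℓ} jump ((_ , eq) , min) = ≤-antisym (min (suc n) (s≤s z≤n , jump))
    (≰⇒> λ ℓ≤n → 1+n≰n (≤-trans (≤-reflexive (sym eq)) (R-mono ℓ≤n)))

  module _ (t : ℕ → ℚ)
           (t-hit : ∀ {m ℓ} → 1 ≤ m → FirstHit m ℓ → t m ≡ (1 ÷ s) ^ℚ ℓ)
           (t-miss : ∀ {m} → 1 ≤ m → (∀ ℓ → ¬ (1 ≤ ℓ × R ℓ ≡ m)) → t m ≡ 0ℚ) where

    -- The m-th digit equal to 1 stands at the position just before the first hit of `m`, and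
    -- exactly `R n` of the first `n` digits are 1. So the first `R n` terms of the series are the
    -- nonzero terms of the truncated expansion.
    partialSum-R : ∀ n → partialSum t (R n) ≡ digitSum n
    partialSum-R zero = trans (cong (partialSum t) R-0) (sym (÷≡/ 0 1))
    partialSum-R (suc n) with m≤n⇒m<n∨m≡n (digit≤1 n)
    ... | inj₁ d<1 = trans (cong (partialSum t) (trans (R-suc n) (trans (cong (λ z → R n + z) d≡0) (+-identityʳ (R n)))))
                       (trans (partialSum-R n) (sym (digitSum-zero n d≡0)))
      where
      d≡0 : digit n ≡ 0
      d≡0 = n<1⇒n≡0 d<1
    ... | inj₂ d≡1 = trans (cong (partialSum t) jump)
                       (trans (cong₂ ℚ._+_ (partialSum-R n) (term n jump)) (sym (digitSum-one n d≡1)))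
      where
      jump : R (suc n) ≡ suc (R n)
      jump = trans (R-suc n) (trans (cong (λ z → R n + z) d≡1) (+-comm (R n) 1))
      term : ∀ n → R (suc n) ≡ suc (R n) → t (suc (R n)) ≡ (1 ÷ s) ^ℚ suc n
      term n jump = let ℓ , hit = first-hit (s≤s z≤n) (suc n) (≤-reflexive (sym jump)) in
        trans (t-hit (s≤s z≤n) hit) (cong ((1 ÷ s) ^ℚ_) (jump-first-hit jump hit))

    partialSum-cofinal : k ≡ 2 ⊎ 3 ≤ k → ∀ M → ∃[ n ] (M ≤ n × partialSum t M ≡ digitSum n)
    partialSum-cofinal _ zero = 0 , z≤n , sym (÷≡/ 0 1)
    partialSum-cofinal (inj₂ 3≤k) (suc M) =
      let ℓ₁ , large = R-unbounded 3≤k (suc M)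
          ℓ , (_ , eq) , _ = first-hit (s≤s z≤n) ℓ₁ large
      in ℓ , subst (_≤ ℓ) eq (R≤ ℓ) , trans (cong (partialSum t) (sym eq)) (partialSum-R ℓ)
    -- For k = 2 only the value 1 is attained. All partial sums from the first on agree, so they
    -- match the truncation at any positive index.
    partialSum-cofinal (inj₁ k≡2) (suc M) = suc M , ≤-refl , (begin
      partialSum t (suc M)     ≡⟨ constant M ⟩
      partialSum t 1           ≡⟨ cong (partialSum t) (≤-antisym (≤-trans (≤-reflexive (sym (R-1 2≤k))) (R-mono {1} {suc M} (s≤s z≤n))) (R≤1 k≡2 (suc M))) ⟩
      partialSum t (R (suc M)) ≡⟨ partialSum-R (suc M) ⟩
      digitSum (suc M)         ∎)
      where
      open ≡-Reasoning
      constant : ∀ M → partialSum t (suc M) ≡ partialSum t 1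
      constant zero    = refl
      constant (suc M) = trans (cong₂ ℚ._+_ (constant M) (t-miss (s≤s z≤n) λ { ℓ (_ , eq) →
        1+n≰n (≤-trans (s≤s (s≤s z≤n)) (≤-trans (≤-reflexive (sym eq)) (R≤1 k≡2 ℓ))) })) (ℚ.+-identityʳ (partialSum t 1))

    series⟶L : k ≡ 2 ⊎ 3 ≤ k → (λ M → σ ÷ 1 ℚ.* partialSum t M) ⟶ L
    series⟶L k-cases = cofinal⟶L λ M → let n , M≤n , eq = partialSum-cofinal k-cases M in
      n , M≤n , trans (cong (σ ÷ 1 ℚ.*_) eq) (approx-scale n)

  -- The sequence of terms has to be constructed, so the emptiness of each preimage must be decided:
  -- none is empty for 3 ≤ k, and for k = 2 all are from m = 2 on.
  hit-or-miss : k ≡ 2 ⊎ 3 ≤ k → ∀ m → 1 ≤ m → (∃[ ℓ ] FirstHit m ℓ) ⊎ (∀ ℓ → ¬ (1 ≤ ℓ × R ℓ ≡ m))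
  hit-or-miss (inj₂ 3≤k) m 1≤m = let ℓ , large = R-unbounded 3≤k m in inj₁ (first-hit 1≤m ℓ large)
  hit-or-miss (inj₁ k≡2) (suc zero)    1≤m = inj₁ (first-hit 1≤m 1 (≤-reflexive (sym (R-1 2≤k))))
  hit-or-miss (inj₁ k≡2) (suc (suc m)) 1≤m = inj₂ λ { ℓ (_ , eq) →
    1+n≰n (≤-trans (s≤s (s≤s z≤n)) (≤-trans (≤-reflexive (sym eq)) (R≤1 k≡2 ℓ))) }

  L-irrational : 3 ≤ k → Irrational L
  L-irrational 3≤k q conv =
    let P , Q , 1≤Q , bounds = L-rational q conv in Irrationality.expansion-irrational k 3≤k R largest P Q 1≤Q bounds

-- Terms of the series, and the theorem

module _ {k s : ℕ} .{{_ : NonZero s}} {m : ℕ} where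

  Term-hit : ∀ {q ℓ} → Term k s m q → IsMin (r⁻¹ k m) ℓ → q ≡ (+ 1 / s) ^ℚ ℓ
  Term-hit (attained {ℓ₁} (hit₁ , min₁)) (hit , min) = cong ((+ 1 / s) ^ℚ_) (≤-antisym (min₁ _ hit) (min _ hit₁))
  Term-hit (empty none)                  (hit , min) = contradiction hit (none _)

  Term-miss : ∀ {q} → Term k s m q → (∀ ℓ → ¬ r⁻¹ k m ℓ) → q ≡ 0ℚ
  Term-miss (attained (hit , _)) none = contradiction hit (none _)
  Term-miss (empty _)            none = refl

  Term-exists : (∃[ ℓ ] IsMin (r⁻¹ k m) ℓ) ⊎ (∀ ℓ → ¬ r⁻¹ k m ℓ) → ∃[ q ] Term k s m q
  Term-exists (inj₁ (ℓ , hit)) = _ , attained hit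
  Term-exists (inj₂ none)      = _ , empty none

theorem1 : ∀ (k s : ℕ) .{{_ : NonZero s}} → 2 ≤ k → 2 ≤ s →
    ∃[ t ] ((∀ m → 1 ≤ m → Term k s m (t m)) ×
    ∃[ L ] ((λ n → + g k s (suc n) / suc n) ⟶ L ×
    (λ M → (+ (s ∸ 1) / 1) * partialSum t M) ⟶ L ×
    (3 ≤ k → Irrational L)))
theorem1 k s@(suc σ) 2≤k (s≤s 1≤σ) = t , t-term , L ,
  ⟶-cong {y = λ n → total digit (suc n) ÷ suc n} {z = L} (λ n → trans (cong (λ z → + z / suc n) (g≡total (suc n))) (sym (÷≡/ (total digit (suc n)) (suc n)))) density⟶L ,
  ⟶-cong {y = λ M → σ ÷ 1 * partialSum t M} {z = L} (λ M → cong (_* partialSum t M) (sym (÷≡/ σ 1))) (series⟶L t t-hit t-miss k-cases) ,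
  L-irrational
  where
  1≤k : 1 ≤ k
  1≤k = <⇒≤ 2≤k
  open Digits σ 1≤σ using (total)
  open Series k 2≤k σ 1≤σ (r k) (r-largest 1≤k)
  open Chain.GPFreeSize s (s≤s 1≤σ) k (r k) (r-largest 1≤k)
  open Limits σ 1≤σ digit digit≤1

  k-cases : k ≡ 2 ⊎ 3 ≤ k
  k-cases with m≤n⇒m<n∨m≡n 2≤k
  ... | inj₁ 3≤k = inj₂ 3≤k
  ... | inj₂ 2≡k = inj₁ (sym 2≡k)

  g≡total : ∀ n → g k s n ≡ total digit n
  g≡total n = IsLargest-unique (g-largest 1≤k s n) (largest-GPFree n)

  t : ℕ → ℚ
  t zero      = 0ℚ
  t m@(suc _) = proj₁ (Term-exists {k} {s} {m} (hit-or-miss k-cases m (s≤s z≤n)))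

  t-term : ∀ m → 1 ≤ m → Term k s m (t m)
  t-term m@(suc _) _ = proj₂ (Term-exists {k} {s} {m} (hit-or-miss k-cases m (s≤s z≤n)))

  t-hit : ∀ {m ℓ} → 1 ≤ m → IsMin (r⁻¹ k m) ℓ → t m ≡ (1 ÷ s) ^ℚ ℓ
  t-hit {m} {ℓ} 1≤m hit = trans (Term-hit (t-term m 1≤m) hit) (cong (_^ℚ ℓ) (sym (÷≡/ 1 s)))

  t-miss : ∀ {m} → 1 ≤ m → (∀ ℓ → ¬ r⁻¹ k m ℓ) → t m ≡ 0ℚ
  t-miss {m} 1≤m none = Term-miss (t-term m 1≤m) none
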